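{- Let $0\le l\le n$. Let $A\in \mathrm{GL}_n(k((z)))$ have dominant coweight $\rho(A)=(1^l)=(1^l,0^{n-l})$ and let $B\in\mathrm{GL}_n(k((z)))$. Write the symmetric coweights as $\sigma(B)=(a_1,\dots,a_n)$ and $\sigma(AB)=(b_1,\dots,b_n)$, in decreasing order. Then $a_i-1\le b_i\le a_i+1$ for all $1\le i\le n$.
   Context: $k$ is a finite field with $\mathrm{char}(k)\ne 2$. Let $G=\mathrm{GL}_n(k((z)))$, $K=\mathrm{GL}_n(k[[z]])$, $H=\mathrm{GL}_n(k((z^2)))$. Dominant coweight: every $g\in G$ lies in $K\,\mathrm{diag}(z^{\lambda_1},\dots,z^{\lambda_n})\,K$ for a unique sequence of integers $\lambda_1\ge\dots\ge\lambda_n$; put $\rho(g)=(\lambda_1,\dots,\lambda_n)$. Strings of zeros in such sequences may be omitted when writing them. Symmetric coweight: every $g\in G$ lies in $K\Lambda H$ for a block diagonal matrix $\Lambda$ with diagonal blocks among $(1)$, $(z)$, $\begin{pmatrix}1&z\\0&z^i\end{pmatrix}$ ($i>1$), and $\Lambda$ is unique up to the order of the blocks. The symmetric coweight $\sigma(g)$ is the decreasing sequence of length $n$ obtained by letting each block $(1)$ contribute $0$, each block $(z)$ contribute $1$, and each block $\begin{pmatrix}1&z\\0&z^i\end{pmatrix}$ contribute $i$ and $0$. -}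

module Defs where

open import Algebra.Apartness.Bundles using (HeytingField; HeytingCommutativeRing)
open import Algebra.Bundles using (CommutativeRing)
open import Algebra.Bundles.Raw using (RawSemiring)
import Algebra.Definitions.RawMonoid as RawMonoidDefs
open import Data.Bool.Base using (if_then_else_)
open import Data.Fin.Base as Fin using (Fin; toℕ)
import Data.Fin.Properties as Fin
open import Data.Integer.Base as ℤ using (ℤ; +_; -[1+_]; 0ℤ; 1ℤ)
open import Data.Nat.Base as ℕ using (ℕ; zero; suc)
import Data.Nat.Properties as ℕ
open import Data.Product.Base using (_×_; ∃-syntax)
open import Data.Vec.Functional using (Vector; []; _∷_; _++_; map; replicate)
open import Data.Vec.Functional.Relation.Binary.Permutation using (_↭_)
open import Function.Base using (_∘_)
open import Function.Bundles using (Inverse)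
open import Level using (_⊔_)
open import Relation.Binary.PropositionalEquality.Properties using (setoid)
open import Relation.Nullary.Decidable.Core using (does)
open import Relation.Nullary.Negation.Core using (¬_)
open import Relation.Unary using (Pred; _∈_; U)

-- Finiteness makes _≈_ decidable, and the apartness of a Heyting field is
-- then equivalent to ¬_≈_, so a finite Heyting field is the same thing as a
-- finite field in the usual sense.
IsFinite : ∀ {c ℓ₁ ℓ₂} → HeytingField c ℓ₁ ℓ₂ → Set (c ⊔ ℓ₁)
IsFinite k = ∃[ q ] Inverse (HeytingField.setoid k) (setoid (Fin q))

Char≢2 : ∀ {c ℓ₁ ℓ₂} → HeytingField c ℓ₁ ℓ₂ → Set ℓ₁
Char≢2 k = ¬ (1# + 1# ≈ 0#)
  where open HeytingField k

Decreasing : ∀ {n} → Vector ℤ n → Set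
Decreasing a = ∀ i j → i Fin.≤ j → a j ℤ.≤ a i

-- The sequence (1ˡ , 0ⁿ⁻ˡ).
ones : ∀ {n} → ℕ → Vector ℤ n
ones l i = if does (toℕ i ℕ.<? l) then 1ℤ else 0ℤ

-- The blocks (1), (z) and (1 z ; 0 zⁱ) with i > 1, indexed by their size.
data Block : ℕ → Set where
  ⟨1⟩ : Block 1
  ⟨z⟩ : Block 1
  ⟨1z,0z^_⟩ : ∀ i → 1 ℕ.< i → Block 2

infixr 5 _▸_

data Blocks : ℕ → Set where
  ε   : Blocks 0
  _▸_ : ∀ {m n} → Block m → Blocks n → Blocks (m ℕ.+ n)

contribution : ∀ {m} → Block m → Vector ℤ m
contribution ⟨1⟩             = 0ℤ ∷ []
contribution ⟨z⟩             = 1ℤ ∷ []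
contribution (⟨1z,0z^ i ⟩ _) = + i ∷ 0ℤ ∷ []

contributions : ∀ {n} → Blocks n → Vector ℤ n
contributions ε        = []
contributions (β ▸ βs) = contribution β ++ contributions βs

module LaurentSeries {c ℓ₁ ℓ₂} (k : HeytingField c ℓ₁ ℓ₂) where

  private
    module k = CommutativeRing (HeytingCommutativeRing.commutativeRing
                 (HeytingField.heytingCommutativeRing k))
    module Σk = RawMonoidDefs k.+-rawMonoid

  infix  4 _≈_ _≋_
  infixl 6 _+_
  infixl 7 _*_ _·_
  infixr 6 _⊕_

  -- z^ord · (series 0 + series 1 z + series 2 z² + …).  The leading
  -- coefficient may vanish, so ord is only a lower bound for the valuation,
  -- and different representations are identified by _≈_.
  record Laurent : Set c where
    constructor laurent
    field
      ord    : ℤ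
      series : ℕ → k.Carrier

  open Laurent

  -- Extension by zero to negative indices.
  extend : (ℕ → k.Carrier) → ℤ → k.Carrier
  extend s (+ m)    = s m
  extend s -[1+ _ ] = k.0#

  coeff : Laurent → ℤ → k.Carrier
  coeff f m = extend (series f) (m ℤ.- ord f)

  _≈_ : Laurent → Laurent → Set ℓ₁
  f ≈ g = ∀ m → coeff f m k.≈ coeff g m

  z^ : ℤ → Laurent
  z^ m = laurent m one
    where
    one : ℕ → k.Carrier
    one zero    = k.1#
    one (suc _) = k.0#

  0# 1# : Laurent
  0# = laurent 0ℤ λ _ → k.0#
  1# = z^ 0ℤ

  _+_ : Laurent → Laurent → Laurent
  f + g = laurent o λ m → coeff f (o ℤ.+ + m) k.+ coeff g (o ℤ.+ + m)
    where o = ord f ℤ.⊓ ord g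

  _*_ : Laurent → Laurent → Laurent
  f * g = laurent (ord f ℤ.+ ord g) λ m →
    Σk.sum {suc m} λ i → series f (toℕ i) k.* series g (m ℕ.∸ toℕ i)

  rawSemiring : RawSemiring c ℓ₁
  rawSemiring = record
    { Carrier = Laurent ; _≈_ = _≈_
    ; _+_ = _+_ ; _*_ = _*_ ; 0# = 0# ; 1# = 1# }

  open RawMonoidDefs (RawSemiring.+-rawMonoid rawSemiring) using (sum)

  -- The subrings k[[z]] and k((z²)) of k((z)): no negative, respectively no
  -- odd, powers of z.
  k[[z]] k⦅z²⦆ : Pred Laurent ℓ₁
  k[[z]] f = ∀ m → m ℤ.< 0ℤ → coeff f m k.≈ k.0#
  k⦅z²⦆ f = ∀ m → coeff f (1ℤ ℤ.+ + 2 ℤ.* m) k.≈ k.0#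

  Matrix : ℕ → Set c
  Matrix n = Vector (Vector Laurent n) n

  _≋_ : ∀ {n} → Matrix n → Matrix n → Set ℓ₁
  M ≋ N = ∀ i j → M i j ≈ N i j

  _·_ : ∀ {n} → Matrix n → Matrix n → Matrix n
  (M · N) i j = sum λ h → M i h * N h j

  diag : ∀ {n} → Vector Laurent n → Matrix n
  diag d i j = if does (i Fin.≟ j) then d i else 0#

  𝟙 : ∀ {n} → Matrix n
  𝟙 = diag λ _ → 1#

  _⊕_ : ∀ {m n} → Matrix m → Matrix n → Matrix (m ℕ.+ n)
  _⊕_ {m} {n} M N =
    map (_++ replicate n 0#) M ++ map (replicate m 0# ++_) N

  -- GLₙ(S) inside the n × n matrices over k((z)): for a subring S, both the
  -- matrix and its inverse must have entries in S.
  GL : ∀ {ℓ n} → Pred Laurent ℓ → Pred (Matrix n) (c ⊔ ℓ₁ ⊔ ℓ)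
  GL S M = (∀ i j → M i j ∈ S) ×
           ∃[ N ] (∀ i j → N i j ∈ S) × (M · N ≋ 𝟙) × (N · M ≋ 𝟙)

  G K H : ∀ {n} → Pred (Matrix n) (c ⊔ ℓ₁)
  G = GL U
  K = GL k[[z]]
  H = GL k⦅z²⦆

  -- The double coset P M Q.
  DoubleCoset : ∀ {ℓ n} → Pred (Matrix n) ℓ → Matrix n → Pred (Matrix n) ℓ →
                Pred (Matrix n) (c ⊔ ℓ₁ ⊔ ℓ)
  DoubleCoset P M Q g = ∃[ p ] ∃[ q ] p ∈ P × q ∈ Q × (g ≋ (p · M) · q)

  blockMatrix : ∀ {m} → Block m → Matrix m
  blockMatrix ⟨1⟩             = (1# ∷ []) ∷ []
  blockMatrix ⟨z⟩             = (z^ 1ℤ ∷ []) ∷ []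
  blockMatrix (⟨1z,0z^ i ⟩ _) = (1# ∷ z^ 1ℤ ∷ []) ∷
                                (0# ∷ z^ (+ i) ∷ []) ∷ []

  Λ : ∀ {n} → Blocks n → Matrix n
  Λ ε        = []
  Λ (β ▸ βs) = blockMatrix β ⊕ Λ βs

  -- ρ(g) = a.
  HasDominantCoweight : ∀ {n} → Matrix n → Vector ℤ n → Set (c ⊔ ℓ₁)
  HasDominantCoweight g a =
    Decreasing a × g ∈ DoubleCoset K (diag (z^ ∘ a)) K

  -- σ(g) = a.
  HasSymmetricCoweight : ∀ {n} → Matrix n → Vector ℤ n → Set (c ⊔ ℓ₁)
  HasSymmetricCoweight g a =
    ∃[ βs ] g ∈ DoubleCoset K (Λ βs) H × Decreasing a × a ↭ contributions βs

-- Write rows of B and AB as bases of lattices L and L′ over O = k[[z]] in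
-- k((z))ⁿ; then zL ⊆ L′ ⊆ L.  For a lattice L and s ≤ 1 let L_s be the set of
-- x ∈ L whose odd part lies in zˢL.  If L = OⁿΛ for a block matrix Λ with
-- contributions κ, then the image of L_s in L/zL has dimension
-- #{ j | κ_j ≤ 1 - s }.  The odd part commutes with multiplication by matrices
-- over k((z²)), and exchanges with the even part under multiplication by z;
-- hence L′_s ⊆ L_{s-1} and z⁻¹(L′_s ∩ zL) ⊆ L_{s-1}.  Filtering L′/zL′ by
-- zL/zL′ turns these inclusions into
--   #{ j | κ′_j ≤ 1 - s } ≤ #{ j | κ_j ≤ 2 - s },
-- which says a_i ≤ b_i + 1 after sorting.  The argument applied to zL ⊆ L′ in
-- place of L′ ⊆ L gives the other inequality.  Since k is finite, dimensions
-- are compared by counting, so no linear algebra over k is needed.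

module Submission where

open import Defs
open import Algebra.Apartness.Bundles using (HeytingField)
open import Data.Integer.Base as ℤ using (ℤ; 1ℤ)
open import Data.Nat.Base as ℕ using (ℕ)
open import Data.Product.Base using (_×_)
open import Data.Vec.Functional using (Vector)
open import Relation.Unary using (_∈_)

open import Algebra.Apartness.Bundles using (HeytingCommutativeRing)
open import Algebra.Bundles using (AbelianGroup; CommutativeRing; Monoid)
import Algebra.Properties.AbelianGroup as AbelianGroupProperties
import Algebra.Properties.CommutativeMonoid.Sum as Sum
import Algebra.Properties.CommutativeSemigroup as Semigroup
import Algebra.Properties.Ring as RingProperties
import Algebra.Properties.Semiring.Sum as SemiringSum
open import Data.Bool.Base using (if_then_else_; true; false)
open import Data.Fin.Base as Fin
  using (Fin; zero; suc; toℕ; finToFun; funToFin; combine; _↑ˡ_; _↑ʳ_)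
open import Data.Fin.Permutation using (_⟨$⟩ʳ_; _⟨$⟩ˡ_; inverseˡ; inverseʳ)
import Data.Fin.Properties as Fin
open import Data.Integer.Base using (+_; -[1+_]; 0ℤ; -1ℤ; _⊖_)
import Data.Integer.DivMod as ℤ
import Data.Integer.Properties as ℤ
open import Data.Integer.Tactic.RingSolver using (solve-∀)
open import Data.Nat.Base using (zero; suc)
import Data.Nat.Properties as ℕ
open import Data.Parity.Base as ℙ using (Parity; 0ℙ; 1ℙ; _⁻¹)
import Data.Parity.Properties as ℙ
open import Data.Product.Base using (_,_; proj₁; proj₂; ∃-syntax)
open import Data.Sum.Base using (_⊎_; inj₁; inj₂)
open import Data.Vec.Functional using ([]; _∷_; _++_; map; replicate)
open import Data.Vec.Functional.Properties using (lookup-++ˡ; lookup-++ʳ)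
open import Data.Vec.Functional.Relation.Binary.Permutation using (_↭_)
open import Function.Base using (_∘_)
open import Function.Bundles using (Inverse)
open import Level as Level using (_⊔_)
open import Relation.Binary.PropositionalEquality as ≡
  using (_≡_; _≢_; cong; cong₂; subst)
open import Relation.Nullary.Decidable.Core using (Dec; yes; no; does)
open import Relation.Nullary.Negation using (contradiction)

-- The two inclusions give a dimension count only if nothing is counted twice. An x in L′_s is
-- measured in L/zL by its own class and, if that is zero, by the class of z⁻¹x. Both kinds of
-- classes lie in the image of L_{s-1}, and their sum there is direct: if x lies in zL and z⁻¹x + y
-- lies in zL, then x + zy lies in z²L, hence in zL′, so x is zero modulo zL′ and therefore y is
-- zero modulo zL. This is where zL ⊆ L′ enters.
--
-- The bound s ≤ 1 is forced by the exchange of parities. The odd part of z⁻¹x is z⁻¹ times the even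
-- part of x, that is z⁻¹x minus z⁻¹ times the odd part of x. The second term lies in z^(s-1)L, but
-- z⁻¹x is only known to lie in L, and L ⊆ z^(s-1)L needs s ≤ 1.
--
-- The sets are never counted exactly. If a_i > b_i + 1 for some i, take s = 1 - b_i, which is at
-- most 1 because contributions are nonnegative. The image of L′_s then contains n - i + 1
-- coordinate directions, and that of L_{s-1} lies in the span of n - i of them, against the count.

-- Rows and square matrices over a commutative ring.

module MatrixProperties {c ℓ} (R : CommutativeRing c ℓ) where

  open CommutativeRing R
  open Sum +-commutativeMonoid public
    using (sum; sum-cong-≋; ∑-distrib-+; ∑-comm; sum-replicate-zero)
  open SemiringSum semiring using (*-distribˡ-sum; *-distribʳ-sum)
  open RingProperties ring public using (-‿distribʳ-*; -‿+-comm; -1*x≈-x)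
  open Semigroup *-commutativeSemigroup using (x∙yz≈y∙xz)
  open import Relation.Binary.Reasoning.Setoid setoid

  infix  4 _≋_ _≈ʳ_
  infixl 7 _⋆_ _·_

  Row Matrix : ℕ → Set c
  Row n    = Vector Carrier n
  Matrix n = Vector (Row n) n

  _≈ʳ_ : ∀ {n} → Row n → Row n → Set ℓ
  ξ ≈ʳ η = ∀ j → ξ j ≈ η j

  _≋_ : ∀ {n} → Matrix n → Matrix n → Set ℓ
  M ≋ N = ∀ i j → M i j ≈ N i j

  _⋆_ : ∀ {n} → Row n → Matrix n → Row n
  (ξ ⋆ M) j = sum λ h → ξ h * M h j

  _·_ : ∀ {n} → Matrix n → Matrix n → Matrix n
  (M · N) i = M i ⋆ N

  diag : ∀ {n} → Row n → Matrix n
  diag d i j = if does (i Fin.≟ j) then d i else 0#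

  𝟙 : ∀ {n} → Matrix n
  𝟙 = diag λ _ → 1#

  sum-zero : ∀ {n} (f : Row n) → (∀ i → f i ≈ 0#) → sum f ≈ 0#
  sum-zero {n} f f≈0 = trans (sum-cong-≋ f≈0) (sum-replicate-zero n)

  sum-single : ∀ {n} (f : Row n) j → (∀ {i} → i ≢ j → f i ≈ 0#) → sum f ≈ f j
  sum-single f zero    f≈0 = trans (+-congˡ (sum-zero (f ∘ suc) λ i → f≈0 λ ())) (+-identityʳ _)
  sum-single f (suc j) f≈0 = trans (+-congʳ (f≈0 λ ())) (trans (+-identityˡ _)
    (sum-single (f ∘ suc) j λ i≢j → f≈0 (i≢j ∘ Fin.suc-injective)))

  diag-≡ : ∀ {n} (d : Row n) j → diag d j j ≡ d j
  diag-≡ d j with j Fin.≟ j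
  ... | yes _  = ≡.refl
  ... | no j≢j = contradiction ≡.refl j≢j

  diag-≢ : ∀ {n} (d : Row n) {i j} → i ≢ j → diag d i j ≡ 0#
  diag-≢ d {i} {j} i≢j with i Fin.≟ j
  ... | yes i≡j = contradiction i≡j i≢j
  ... | no _    = ≡.refl

  ⋆-congˡ : ∀ {n} {ξ} {M N : Matrix n} → M ≋ N → ξ ⋆ M ≈ʳ ξ ⋆ N
  ⋆-congˡ M≋N j = sum-cong-≋ λ h → *-congˡ (M≋N h j)

  ⋆-congʳ : ∀ {n} {M : Matrix n} {ξ η} → ξ ≈ʳ η → ξ ⋆ M ≈ʳ η ⋆ M
  ⋆-congʳ ξ≈η j = sum-cong-≋ λ h → *-congʳ (ξ≈η h)

  ⋆-assoc : ∀ {n} ξ (M N : Matrix n) → (ξ ⋆ M) ⋆ N ≈ʳ ξ ⋆ (M · N)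
  ⋆-assoc {n} ξ M N j = begin
    (sum λ h → (sum λ i → ξ i * M i h) * N h j)
      ≈⟨ sum-cong-≋ {n} (λ h → trans (*-distribʳ-sum (N h j) λ i → ξ i * M i h)
                                    (sum-cong-≋ {n} λ i → *-assoc (ξ i) (M i h) (N h j))) ⟩
    (sum λ h → sum λ i → ξ i * (M i h * N h j))
      ≈⟨ ∑-comm (λ h i → ξ i * (M i h * N h j)) ⟩
    (sum λ i → sum λ h → ξ i * (M i h * N h j))
      ≈⟨ sum-cong-≋ {n} (λ i → sym (*-distribˡ-sum (ξ i) λ h → M i h * N h j)) ⟩
    (sum λ i → ξ i * sum λ h → M i h * N h j) ∎

  ⋆-diag : ∀ {n} ξ (d : Row n) j → (ξ ⋆ diag d) j ≈ ξ j * d j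
  ⋆-diag ξ d j = trans
    (sum-single (λ h → ξ h * diag d h j) j λ {i} i≢j → trans (*-congˡ (reflexive (diag-≢ d i≢j))) (zeroʳ _))
    (*-congˡ (reflexive (diag-≡ d j)))

  ·-cong : ∀ {n} {M M′ N N′ : Matrix n} → M ≋ M′ → N ≋ N′ → M · N ≋ M′ · N′
  ·-cong M≋ N≋ i j = sum-cong-≋ λ h → *-cong (M≋ i h) (N≋ h j)

  diag-· : ∀ {n} (d : Row n) (M : Matrix n) i j → (diag d · M) i j ≈ d i * M i j
  diag-· d M i j = trans
    (sum-single (λ h → diag d i h * M h j) i λ {h} h≢i → trans (*-congʳ (reflexive (diag-≢ d (h≢i ∘ ≡.sym)))) (zeroˡ _))
    (*-congʳ (reflexive (diag-≡ d i)))

  ·-monoid : ℕ → Monoid c ℓ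
  ·-monoid n = record
    { Carrier = Matrix n ; _≈_ = _≋_ ; _∙_ = _·_ ; ε = 𝟙
    ; isMonoid = record
      { isSemigroup = record
        { isMagma = record
          { isEquivalence = record
            { refl  = λ _ _ → refl
            ; sym   = λ e i j → sym (e i j)
            ; trans = λ e e′ i j → trans (e i j) (e′ i j) }
          ; ∙-cong = ·-cong }
        ; assoc = λ M N P i → ⋆-assoc (M i) N P }
      ; identity = (λ M i j → trans (diag-· _ M i j) (*-identityˡ _))
                 , (λ M i j → trans (⋆-diag (M i) _ j) (*-identityʳ _)) } }

  scalar : ∀ {n} → Carrier → Matrix n
  scalar x = diag λ _ → x

  scalar-central : ∀ {n} x (M : Matrix n) → scalar x · M ≋ M · scalar x
  scalar-central x M i j = begin
    (scalar x · M) i j  ≈⟨ diag-· _ M i j ⟩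
    x * M i j           ≈⟨ *-comm _ _ ⟩
    M i j * x           ≈⟨ sym (⋆-diag (M i) _ j) ⟩
    (M · scalar x) i j  ∎

  infixl 6 _⊞_ _⊟_
  infixl 7 _◂_
  _⊞_ _⊟_ : ∀ {n} → Row n → Row n → Row n
  (ξ ⊞ η) j = ξ j + η j
  (ξ ⊟ η) j = ξ j - η j

  _◂_ : ∀ {n} → Carrier → Row n → Row n
  (x ◂ ξ) j = x * ξ j

  ⋆-distribʳ-⊞ : ∀ {n} (M : Matrix n) ξ η → (ξ ⊞ η) ⋆ M ≈ʳ ξ ⋆ M ⊞ η ⋆ M
  ⋆-distribʳ-⊞ {n} M ξ η j = trans (sum-cong-≋ {n} λ h → distribʳ (M h j) (ξ h) (η h))
    (∑-distrib-+ (λ h → ξ h * M h j) (λ h → η h * M h j))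

  ◂-⋆ : ∀ {n} x ξ (M : Matrix n) → (x ◂ ξ) ⋆ M ≈ʳ x ◂ (ξ ⋆ M)
  ◂-⋆ {n} x ξ M j = trans (sum-cong-≋ {n} λ h → *-assoc x (ξ h) (M h j))
    (sym (*-distribˡ-sum x λ h → ξ h * M h j))

  ⋆-◂ : ∀ {n} x ξ (M : Matrix n) → ξ ⋆ (λ i → x ◂ M i) ≈ʳ x ◂ (ξ ⋆ M)
  ⋆-◂ {n} x ξ M j = trans (sum-cong-≋ {n} λ h → x∙yz≈y∙xz (ξ h) x (M h j))
    (sym (*-distribˡ-sum x λ h → ξ h * M h j))

  ⋆-distribʳ-⊟ : ∀ {n} (M : Matrix n) ξ η → (ξ ⊟ η) ⋆ M ≈ʳ ξ ⋆ M ⊟ η ⋆ M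
  ⋆-distribʳ-⊟ M ξ η j = begin
    ((ξ ⊟ η) ⋆ M) j                        ≈⟨ ⋆-distribʳ-⊞ M ξ (λ h → - η h) j ⟩
    (ξ ⋆ M) j + ((λ h → - η h) ⋆ M) j      ≈⟨ +-congˡ (⋆-congʳ {M = M} (λ h → sym (-1*x≈-x (η h))) j) ⟩
    (ξ ⋆ M) j + (((- 1#) ◂ η) ⋆ M) j       ≈⟨ +-congˡ (◂-⋆ (- 1#) η M j) ⟩
    (ξ ⋆ M) j + (- 1#) * (η ⋆ M) j         ≈⟨ +-congˡ (-1*x≈-x _) ⟩
    (ξ ⋆ M ⊟ η ⋆ M) j                      ∎

-- Passing to adapted bases, as cancellation in a monoid.

module BasisChange {c ℓ} (M : Monoid c ℓ) where

  open Monoid M renaming (ε to 𝟏)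
  open import Relation.Binary.Reasoning.Setoid setoid

  Central : Carrier → Set (c ⊔ ℓ)
  Central ζ = ∀ x → ζ ∙ x ≈ x ∙ ζ

  cancelʳ : ∀ {q q⁻¹} x → q ∙ q⁻¹ ≈ 𝟏 → (x ∙ q) ∙ q⁻¹ ≈ x
  cancelʳ x e = trans (assoc x _ _) (trans (∙-congˡ e) (identityʳ x))

  cancelˡ : ∀ {p p⁻¹} x → p⁻¹ ∙ p ≈ 𝟏 → p⁻¹ ∙ (p ∙ x) ≈ x
  cancelˡ x e = trans (sym (assoc _ _ x)) (trans (∙-congʳ e) (identityˡ x))

  -- The left factor is `t` rewritten in the bases given by the two factorizations. Everything from
  -- K is absorbed into it, and only `ζ` and the factors from H stay on the right, where homogeneity
  -- is preserved.
  basis-change : ∀ {t ζ b b′ p λ₁ q q⁻¹ p′ p′⁻¹ λ′ q′} → Central ζ →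
    q ∙ q⁻¹ ≈ 𝟏 → p′⁻¹ ∙ p′ ≈ 𝟏 → b ≈ (p ∙ λ₁) ∙ q → b′ ≈ (p′ ∙ λ′) ∙ q′ → t ∙ b ≈ ζ ∙ b′ →
    ((p′⁻¹ ∙ t) ∙ p) ∙ λ₁ ≈ λ′ ∙ (ζ ∙ (q′ ∙ q⁻¹))
  basis-change {t} {ζ} {b} {b′} {p} {λ₁} {q} {q⁻¹} {p′} {p′⁻¹} {λ′} {q′} central qq⁻¹ p′⁻¹p′ eb eb′ tb = begin
    ((p′⁻¹ ∙ t) ∙ p) ∙ λ₁                   ≈⟨ assoc _ _ _ ⟩
    (p′⁻¹ ∙ t) ∙ (p ∙ λ₁)                   ≈⟨ ∙-congˡ (cancelʳ (p ∙ λ₁) qq⁻¹) ⟨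
    (p′⁻¹ ∙ t) ∙ (((p ∙ λ₁) ∙ q) ∙ q⁻¹)     ≈⟨ ∙-congˡ (∙-congʳ eb) ⟨
    (p′⁻¹ ∙ t) ∙ (b ∙ q⁻¹)                  ≈⟨ assoc _ _ _ ⟩
    p′⁻¹ ∙ (t ∙ (b ∙ q⁻¹))                  ≈⟨ ∙-congˡ (assoc _ _ _) ⟨
    p′⁻¹ ∙ ((t ∙ b) ∙ q⁻¹)                  ≈⟨ ∙-congˡ (∙-congʳ (trans tb (central b′))) ⟩
    p′⁻¹ ∙ ((b′ ∙ ζ) ∙ q⁻¹)                 ≈⟨ ∙-congˡ (∙-congʳ (∙-congʳ (trans eb′ (assoc _ _ _)))) ⟩
    p′⁻¹ ∙ (((p′ ∙ (λ′ ∙ q′)) ∙ ζ) ∙ q⁻¹)   ≈⟨ ∙-congˡ (trans (assoc _ _ _) (assoc _ _ _)) ⟩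
    p′⁻¹ ∙ (p′ ∙ ((λ′ ∙ q′) ∙ (ζ ∙ q⁻¹)))   ≈⟨ cancelˡ _ p′⁻¹p′ ⟩
    (λ′ ∙ q′) ∙ (ζ ∙ q⁻¹)                   ≈⟨ assoc _ _ _ ⟩
    λ′ ∙ (q′ ∙ (ζ ∙ q⁻¹))                   ≈⟨ ∙-congˡ (assoc _ _ _) ⟨
    λ′ ∙ ((q′ ∙ ζ) ∙ q⁻¹)                   ≈⟨ ∙-congˡ (∙-congʳ (central q′)) ⟨
    λ′ ∙ ((ζ ∙ q′) ∙ q⁻¹)                   ≈⟨ ∙-congˡ (assoc _ _ _) ⟩
    λ′ ∙ (ζ ∙ (q′ ∙ q⁻¹))                   ∎

  -- The inner factors cancel and the outer ones conjugate a central element. So an inverse up to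
  -- `ζ` survives a change of both bases.
  conjugate-inverse : ∀ {t t′ ζ p p⁻¹ q q⁻¹} → Central ζ → p ∙ p⁻¹ ≈ 𝟏 → q⁻¹ ∙ q ≈ 𝟏 → t ∙ t′ ≈ ζ →
    ((q⁻¹ ∙ t) ∙ p) ∙ ((p⁻¹ ∙ t′) ∙ q) ≈ ζ
  conjugate-inverse {t} {t′} {ζ} {p} {p⁻¹} {q} {q⁻¹} central pp⁻¹ q⁻¹q tt′ = begin
    ((q⁻¹ ∙ t) ∙ p) ∙ ((p⁻¹ ∙ t′) ∙ q)      ≈⟨ ∙-congˡ (assoc _ _ _) ⟩
    ((q⁻¹ ∙ t) ∙ p) ∙ (p⁻¹ ∙ (t′ ∙ q))      ≈⟨ assoc _ _ _ ⟨
    (((q⁻¹ ∙ t) ∙ p) ∙ p⁻¹) ∙ (t′ ∙ q)      ≈⟨ ∙-congʳ (cancelʳ _ pp⁻¹) ⟩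
    (q⁻¹ ∙ t) ∙ (t′ ∙ q)                    ≈⟨ assoc _ _ _ ⟩
    q⁻¹ ∙ (t ∙ (t′ ∙ q))                    ≈⟨ ∙-congˡ (trans (sym (assoc _ _ _)) (∙-congʳ tt′)) ⟩
    q⁻¹ ∙ (ζ ∙ q)                           ≈⟨ ∙-congˡ (central q) ⟩
    q⁻¹ ∙ (q ∙ ζ)                           ≈⟨ cancelˡ ζ q⁻¹q ⟩
    ζ                                       ∎

-- Comparing dimensions by counting.

-- One point is chosen in each fibre by a finite search that sees only the value `h x`, so the
-- choice is constant on fibres. It replaces a linear complement of the kernel.
representative : ∀ {a b} (h : Fin a → Fin b) →
  ∃[ s ] (∀ x → h (s x) ≡ h x) × (∀ {x y} → h x ≡ h y → s x ≡ s y)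
representative {a} {b} h = (λ x → pick (h x) (x , ≡.refl)) , (λ x → pick-fibre (h x) _) ,
  λ {x} {y} hx≡hy → pick-cong hx≡hy
  where
  Fibre : Fin b → Set
  Fibre y = ∃[ x ] h x ≡ y
  fibre? : ∀ y → Dec (Fibre y)
  fibre? y = Fin.any? λ x → h x Fin.≟ y
  -- The second argument only refutes the empty case, so the result depends on `y` alone.
  pick : ∀ y → Fibre y → Fin a
  pick y p with fibre? y
  ... | yes (x , _) = x
  ... | no ¬p       = contradiction p ¬p
  pick-fibre : ∀ y p → h (pick y p) ≡ y
  pick-fibre y p with fibre? y
  ... | yes (x , hx≡y) = hx≡y
  ... | no ¬p          = contradiction p ¬p
  pick-irrelevant : ∀ y p p′ → pick y p ≡ pick y p′
  pick-irrelevant y p p′ with fibre? y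
  ... | yes _ = ≡.refl
  ... | no ¬p = contradiction p ¬p
  pick-cong : ∀ {y y′ p p′} → y ≡ y′ → pick y p ≡ pick y′ p′
  pick-cong {y} ≡.refl = pick-irrelevant y _ _

funToFin-cong : ∀ {m n} {f g : Fin m → Fin n} → (∀ i → f i ≡ g i) → funToFin f ≡ funToFin g
funToFin-cong {zero}  f≗g = ≡.refl
funToFin-cong {suc m} f≗g = cong₂ combine (f≗g zero) (funToFin-cong (f≗g ∘ suc))

module Counting {c ℓ} (G : AbelianGroup c ℓ) {N} (1<N : 1 ℕ.< N)
  (enumeration : Inverse (AbelianGroup.setoid G) (≡.setoid (Fin N))) where

  open AbelianGroup G renaming (ε to 0ᴳ; _⁻¹ to infix 8 -_)
  open AbelianGroupProperties G
  open Inverse enumeration using (to; from; to-cong; from-cong; strictlyInverseˡ; strictlyInverseʳ)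
  open Semigroup commutativeSemigroup using (interchange)
  open import Relation.Binary.Reasoning.Setoid setoid

  infix 4 _≗ᵛ_
  infixl 6 _⊖ᵛ_

  V : ℕ → Set c
  V n = Vector Carrier n

  _≗ᵛ_ : ∀ {n} → V n → V n → Set ℓ
  x ≗ᵛ y = ∀ i → x i ≈ y i

  _⊖ᵛ_ : ∀ {n} → V n → V n → V n
  (x ⊖ᵛ y) i = x i - y i

  record IsAdditive {m n} (f : V m → V n) : Set (c ⊔ ℓ) where
    field
      f-cong : ∀ {x y} → x ≗ᵛ y → f x ≗ᵛ f y
      f-⊖    : ∀ x y → f (x ⊖ᵛ y) ≗ᵛ f x ⊖ᵛ f y

  encode : ∀ {n} → V n → Fin (N ℕ.^ n)
  encode x = funToFin (to ∘ x)

  decode : ∀ {n} → Fin (N ℕ.^ n) → V n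
  decode e = from ∘ finToFun e

  encode-cong : ∀ {n} {x y : V n} → x ≗ᵛ y → encode x ≡ encode y
  encode-cong x≗y = funToFin-cong (to-cong ∘ x≗y)

  decode-encode : ∀ {n} (x : V n) → decode (encode x) ≗ᵛ x
  decode-encode x i = trans (from-cong (Fin.finToFun-funToFin (to ∘ x) i)) (strictlyInverseʳ (x i))

  encode-injective : ∀ {n} {x y : V n} → encode x ≡ encode y → x ≗ᵛ y
  encode-injective {x = x} {y} e i = trans (sym (decode-encode x i))
    (trans (reflexive (cong (λ e → decode e i) e)) (decode-encode y i))

  encode-decode : ∀ {n} (e : Fin (N ℕ.^ n)) → encode (decode {n} e) ≡ e
  encode-decode {n} e = ≡.trans (funToFin-cong (strictlyInverseˡ ∘ finToFun {N} {n} e))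
    (Fin.funToFin-finToFin {n} e)

  -- The two sides have N^p and N^q elements, and N^p exceeds N^q when p > q because N > 1.
  injection⇒≤ : ∀ {p q} (Φ : V p → V q) →
                (∀ e e′ → Φ (decode e) ≗ᵛ Φ (decode e′) → decode {p} e ≗ᵛ decode e′) → p ℕ.≤ q
  injection⇒≤ {p} {q} Φ inj with p ℕ.≤? q
  ... | yes p≤q = p≤q
  ... | no  p≰q = contradiction
    (Fin.injective⇒≤ {f = encode ∘ Φ ∘ decode {p}} λ {e} {e′} eq →
      ≡.trans (≡.sym (encode-decode {p} e))
        (≡.trans (encode-cong (inj e e′ (encode-injective eq))) (encode-decode {p} e′)))
    (ℕ.<⇒≱ (ℕ.^-monoʳ-< N 1<N (ℕ.≰⇒> p≰q)))

  -- In terms of dimensions: dim (im h) + dim (ker h) ≤ q, because g embeds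
  -- ker h in a complement of im h.  The map Φ glues g on ker h and h on a set
  -- of representatives modulo ker h.
  kernel-image-≤ : ∀ {p q} (h g : V p → V q) → IsAdditive h → IsAdditive g →
    (∀ x y → (∀ i → h x i ≈ 0ᴳ) → (∀ i → g x i ∙ h y i ≈ 0ᴳ) →
      (∀ i → x i ≈ 0ᴳ) × (∀ i → h y i ≈ 0ᴳ)) → p ℕ.≤ q
  kernel-image-≤ {p} {q} h g h-additive g-additive independent = injection⇒≤ Φ Φ-injective
    where
    module h = IsAdditive h-additive
    module g = IsAdditive g-additive
    hᶠ : Fin (N ℕ.^ p) → Fin (N ℕ.^ q)
    hᶠ = encode ∘ h ∘ decode
    s : Fin (N ℕ.^ p) → Fin (N ℕ.^ p)
    s = proj₁ (representative hᶠ)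
    r : V p → V p
    r x = decode (s (encode x))
    h-r : ∀ x → h (r x) ≗ᵛ h x
    h-r x i = trans (encode-injective (proj₁ (proj₂ (representative hᶠ)) (encode x)) i)
      (h.f-cong (decode-encode x) i)
    r-cong : ∀ {x y} → h x ≗ᵛ h y → r x ≗ᵛ r y
    r-cong {x} {y} hx≗hy i = reflexive (cong (λ e → decode e i)
      (proj₂ (proj₂ (representative hᶠ)) (encode-cong λ j → trans (h.f-cong (decode-encode x) j)
        (trans (hx≗hy j) (sym (h.f-cong (decode-encode y) j))))))
    Φ : V p → V q
    Φ x i = g (x ⊖ᵛ r x) i ∙ h (r x) i
    injective : ∀ x y → Φ x ≗ᵛ Φ y → x ≗ᵛ y
    injective x y Φx≗Φy i = begin
      x i                      ≈⟨ //-rightDividesˡ (r x i) (x i) ⟨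
      (x i - r x i) ∙ r x i   ≈⟨ ∙-cong (x∙y⁻¹≈ε⇒x≈y _ _ (proj₁ zeros i)) (r-cong hx≗hy i) ⟩
      (y i - r y i) ∙ r y i   ≈⟨ //-rightDividesˡ (r y i) (y i) ⟩
      y i                      ∎
      where
      d e : V p
      -- Subtracting Φ y from Φ x splits as `g d` plus `h e` with `d` in the kernel of `h`, which is
      -- the situation of `independent`. Its conclusion h e = 0 says that x and y have the same
      -- representative, and then d = 0 gives x = y.
      d = (x ⊖ᵛ r x) ⊖ᵛ (y ⊖ᵛ r y)
      e = r x ⊖ᵛ r y
      h-⊖-r : ∀ x i → h (x ⊖ᵛ r x) i ≈ 0ᴳ
      h-⊖-r x i = trans (h.f-⊖ x (r x) i) (x≈y⇒x∙y⁻¹≈ε (sym (h-r x i)))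
      hd≈ε : ∀ i → h d i ≈ 0ᴳ
      hd≈ε i = trans (h.f-⊖ _ _ i) (x≈y⇒x∙y⁻¹≈ε (trans (h-⊖-r x i) (sym (h-⊖-r y i))))
      gd∙he≈ε : ∀ i → g d i ∙ h e i ≈ 0ᴳ
      gd∙he≈ε i = begin
        g d i ∙ h e i
          ≈⟨ ∙-cong (g.f-⊖ _ _ i) (h.f-⊖ _ _ i) ⟩
        (g (x ⊖ᵛ r x) i - g (y ⊖ᵛ r y) i) ∙ (h (r x) i - h (r y) i)
          ≈⟨ interchange _ _ _ _ ⟩
        Φ x i ∙ (- g (y ⊖ᵛ r y) i ∙ - h (r y) i)
          ≈⟨ ∙-congˡ (⁻¹-∙-comm _ _) ⟩
        Φ x i - Φ y i
          ≈⟨ x≈y⇒x∙y⁻¹≈ε (Φx≗Φy i) ⟩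
        0ᴳ ∎
      zeros : (∀ i → d i ≈ 0ᴳ) × (∀ i → h e i ≈ 0ᴳ)
      zeros = independent d e hd≈ε gd∙he≈ε
      hx≗hy : h x ≗ᵛ h y
      hx≗hy j = begin
        h x j      ≈⟨ h-r x j ⟨
        h (r x) j  ≈⟨ x∙y⁻¹≈ε⇒x≈y _ _ (trans (sym (h.f-⊖ (r x) (r y) j)) (proj₂ zeros j)) ⟩
        h (r y) j  ≈⟨ h-r y j ⟩
        h y j      ∎
    Φ-injective : ∀ e e′ → Φ (decode e) ≗ᵛ Φ (decode e′) → decode {p} e ≗ᵛ decode e′
    Φ-injective e e′ = injective (decode e) (decode e′)

-- Parity of integers.

parity : ℤ → Parity
parity (+ n)    = ℕ.parity n
parity -[1+ n ] = ℕ.parity (suc n)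

parity-⊖ : ∀ m n → parity (m ⊖ n) ≡ ℕ.parity m ℙ.+ ℕ.parity n
parity-⊖ m       zero    = ≡.sym (ℙ.+-identityʳ _)
parity-⊖ zero    (suc n) = ≡.refl
parity-⊖ (suc m) (suc n) = begin
  parity (suc m ⊖ suc n)                    ≡⟨ cong parity (ℤ.[1+m]⊖[1+n]≡m⊖n m n) ⟩
  parity (m ⊖ n)                            ≡⟨ parity-⊖ m n ⟩
  ℕ.parity m ℙ.+ ℕ.parity n                 ≡⟨ flip₂ (ℕ.parity m) (ℕ.parity n) ⟩
  (ℕ.parity m ⁻¹) ℙ.+ (ℕ.parity n ⁻¹)       ≡⟨ cong₂ ℙ._+_ (suc-parity m) (suc-parity n) ⟨
  ℕ.parity (suc m) ℙ.+ ℕ.parity (suc n)     ∎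
  where
  open ≡.≡-Reasoning
  flip₂ : ∀ p q → p ℙ.+ q ≡ (p ⁻¹) ℙ.+ (q ⁻¹)
  flip₂ 0ℙ q = ≡.sym (ℙ.⁻¹-involutive q)
  flip₂ 1ℙ q = ≡.refl
  suc-parity : ∀ n → ℕ.parity (suc n) ≡ ℕ.parity n ⁻¹
  suc-parity n = ≡.trans (≡.sym (ℙ.⁻¹-involutive _)) (cong _⁻¹ (ℙ.suc-homo-⁻¹ n))

parity-+ : ∀ x y → parity (x ℤ.+ y) ≡ parity x ℙ.+ parity y
parity-+ (+ m)    (+ n)    = ℙ.+-homo-+ m n
parity-+ (+ m)    -[1+ n ] = parity-⊖ m (suc n)
parity-+ -[1+ m ] (+ n)    = ≡.trans (parity-⊖ n (suc m)) (ℙ.+-comm (ℕ.parity n) _)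
parity-+ -[1+ m ] -[1+ n ] = ≡.trans (ℙ.+-homo-+ m n)
  (flip₂ m n)
  where
  flip₂ : ∀ m n → ℕ.parity m ℙ.+ ℕ.parity n ≡ ℕ.parity (suc m) ℙ.+ ℕ.parity (suc n)
  flip₂ m n rewrite ≡.sym (ℙ.suc-homo-⁻¹ m) | ≡.sym (ℙ.suc-homo-⁻¹ n)
    with ℕ.parity (suc m) | ℕ.parity (suc n)
  ... | 0ℙ | 0ℙ = ≡.refl
  ... | 0ℙ | 1ℙ = ≡.refl
  ... | 1ℙ | 0ℙ = ≡.refl
  ... | 1ℙ | 1ℙ = ≡.refl

-- Links the condition defining k((z²)), which speaks of exponents 1 + 2h, to `parity`.
odd-half : ∀ m → parity m ≡ 1ℙ → ∃[ h ] m ≡ 1ℤ ℤ.+ + 2 ℤ.* h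
odd-half m odd = go (m ℤ.%ℕ 2) (ℤ.n%ℕd<d m 2) (ℤ.a≡a%ℕn+[a/ℕn]*n m 2)
  where
  q = m ℤ./ℕ 2
  go : ∀ r → r ℕ.< 2 → m ≡ + r ℤ.+ q ℤ.* + 2 → ∃[ h ] m ≡ 1ℤ ℤ.+ + 2 ℤ.* h
  go 0 _ m≡ = contradiction (begin
    1ℙ                      ≡⟨ odd ⟨
    parity m                ≡⟨ cong parity (≡.trans m≡ (double q)) ⟩
    parity (q ℤ.+ q)        ≡⟨ parity-+ q q ⟩
    parity q ℙ.+ parity q   ≡⟨ ℙ.p+p≡0ℙ (parity q) ⟩
    0ℙ                      ∎) λ ()
    where
    open ≡.≡-Reasoning
    double : ∀ q → 0ℤ ℤ.+ q ℤ.* + 2 ≡ q ℤ.+ q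
    double = solve-∀
  go 1 _ m≡ = q , ≡.trans m≡ (cong (λ x → 1ℤ ℤ.+ x) (ℤ.*-comm q (+ 2)))
  go (suc (suc r)) (ℕ.s≤s (ℕ.s≤s ())) m≡

-- The ring k((z)), seen through the coefficients of its elements; as an
-- abstract interface it keeps the operations on Laurent from unfolding.
record SeriesRing {c ℓ} (F : CommutativeRing c ℓ) : Set (Level.suc (c ⊔ ℓ)) where
  private module F = CommutativeRing F
  field
    commutativeRing : CommutativeRing c ℓ
  open CommutativeRing commutativeRing public hiding (zero)
  field
    coeff      : Carrier → ℤ → F.Carrier
    coeff-cong : ∀ {f g} → f ≈ g → ∀ m → coeff f m F.≈ coeff g m
    coeff-ext  : ∀ {f g} → (∀ m → coeff f m F.≈ coeff g m) → f ≈ g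
    coeff-0    : ∀ m → coeff 0# m F.≈ F.0#
    coeff-+    : ∀ f g m → coeff (f + g) m F.≈ coeff f m F.+ coeff g m
    coeff-neg  : ∀ f m → coeff (- f) m F.≈ F.- coeff f m
    coeff-*-≈0 : ∀ f g m → (∀ i j → i ℤ.+ j ≡ m → coeff f i F.* coeff g j F.≈ F.0#) →
                 coeff (f * g) m F.≈ F.0#
    mono         : F.Carrier → ℤ → Carrier
    coeff-mono-≡ : ∀ a d → coeff (mono a d) d F.≈ a
    coeff-mono-≢ : ∀ a {d m} → m ≢ d → coeff (mono a d) m F.≈ F.0#
    z            : ℤ → Carrier
    z≈mono       : ∀ d → z d ≈ mono F.1# d
    coeff-z*     : ∀ d f m → coeff (z d * f) m F.≈ coeff f (m ℤ.- d)
    part         : Parity → Carrier → Carrier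
    coeff-part-∈ : ∀ p f {m} → parity m ≡ p → coeff (part p f) m F.≈ coeff f m
    coeff-part-∉ : ∀ p f {m} → parity m ≡ p ⁻¹ → coeff (part p f) m F.≈ F.0#

-- Valuation, the even-odd grading, and layers of a lattice.

module Core {c ℓ} (F : CommutativeRing c ℓ) (R : SeriesRing F) where

  module F where
    open CommutativeRing F public
    open RingProperties ring public using (-0#≈0#)
  open SeriesRing R public
  open MatrixProperties commutativeRing public

  coeff-- : ∀ f g m → coeff (f - g) m F.≈ coeff f m F.- coeff g m
  coeff-- f g m = F.trans (coeff-+ f (- g) m) (F.+-congˡ (coeff-neg g m))

  -- f ∈ zᵛk[[z]]
  Val : ℤ → Carrier → Set ℓ
  Val v f = ∀ m → m ℤ.< v → coeff f m F.≈ F.0#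

  Val-cong : ∀ {v f g} → f ≈ g → Val v f → Val v g
  Val-cong f≈g v m m< = F.trans (coeff-cong (sym f≈g) m) (v m m<)

  Val-≤ : ∀ {v w f} → v ℤ.≤ w → Val w f → Val v f
  Val-≤ v≤w val m m<v = val m (ℤ.<-≤-trans m<v v≤w)

  Val-0 : ∀ v → Val v 0#
  Val-0 v m _ = coeff-0 m

  Val-+ : ∀ {v f g} → Val v f → Val v g → Val v (f + g)
  Val-+ {f = f} {g} vf vg m m< = F.trans (coeff-+ f g m)
    (F.trans (F.+-cong (vf m m<) (vg m m<)) (F.+-identityˡ _))

  Val-neg : ∀ {v f} → Val v f → Val v (- f)
  Val-neg {f = f} vf m m< = F.trans (coeff-neg f m)
    (F.trans (F.-‿cong (vf m m<)) F.-0#≈0#)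

  Val-* : ∀ {v w f g} → Val v f → Val w g → Val (v ℤ.+ w) (f * g)
  Val-* {v} {w} {f} {g} vf vg m m< = coeff-*-≈0 f g m step
    where
    step : ∀ i j → i ℤ.+ j ≡ m → coeff f i F.* coeff g j F.≈ F.0#
    step i j i+j≡m with i ℤ.<? v | j ℤ.<? w
    ... | yes i<v | _       = F.trans (F.*-congʳ (vf i i<v)) (F.zeroˡ _)
    ... | no _    | yes j<w = F.trans (F.*-congˡ (vg j j<w)) (F.zeroʳ _)
    ... | no i≮v  | no j≮w  = contradiction
      (ℤ.≤-<-trans (ℤ.+-mono-≤ (ℤ.≮⇒≥ i≮v) (ℤ.≮⇒≥ j≮w)) (subst (ℤ._< v ℤ.+ w) (≡.sym i+j≡m) m<))
      (ℤ.<-irrefl ≡.refl)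

  Val-sum : ∀ {n v} (f : Row n) → (∀ i → Val v (f i)) → Val v (sum f)
  Val-sum {zero}  f vf = Val-0 _
  Val-sum {suc n} f vf = Val-+ (vf zero) (Val-sum (f ∘ suc) (vf ∘ suc))

  Val-⋆ : ∀ {n v w} {ξ : Row n} {M : Matrix n} →
          (∀ i → Val v (ξ i)) → (∀ i j → Val w (M i j)) → ∀ j → Val (v ℤ.+ w) ((ξ ⋆ M) j)
  Val-⋆ vξ vM j = Val-sum _ λ h → Val-* (vξ h) (vM h j)

  Val-z* : ∀ {v f} d → Val v f → Val (d ℤ.+ v) (z d * f)
  Val-z* {v} {f} d vf m m< = F.trans (coeff-z* d f m) (vf (m ℤ.- d)
    (≡.subst (m ℤ.- d ℤ.<_) (cancel d v) (ℤ.+-monoˡ-< (ℤ.- d) m<)))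
    where
    cancel : ∀ d v → d ℤ.+ v ℤ.- d ≡ v
    cancel = solve-∀

  z-+ : ∀ d e f → z d * (z e * f) ≈ z (d ℤ.+ e) * f
  z-+ d e f = coeff-ext λ m → F.trans (coeff-z* d _ m) (F.trans (coeff-z* e f _)
    (F.trans (F.reflexive (cong (coeff f) (shuffle m d e))) (F.sym (coeff-z* (d ℤ.+ e) f m))))
    where
    shuffle : ∀ m d e → m ℤ.- d ℤ.- e ≡ m ℤ.- (d ℤ.+ e)
    shuffle = solve-∀

  z-0 : ∀ f → z 0ℤ * f ≈ f
  z-0 f = coeff-ext λ m → F.trans (coeff-z* 0ℤ f m)
    (F.reflexive (cong (coeff f) (ℤ.+-identityʳ m)))

  -- The grading of k((z)) by parity: degree `0ℙ` is k((z²)) and degree `1ℙ` is z k((z²)).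
  Homogeneous : Parity → Carrier → Set ℓ
  Homogeneous p f = ∀ m → parity m ≡ p ⁻¹ → coeff f m F.≈ F.0#

  parity-cases : ∀ p m → parity m ≡ p ⊎ parity m ≡ p ⁻¹
  parity-cases p m with parity m
  parity-cases 0ℙ m | 0ℙ = inj₁ ≡.refl
  parity-cases 0ℙ m | 1ℙ = inj₂ ≡.refl
  parity-cases 1ℙ m | 0ℙ = inj₂ ≡.refl
  parity-cases 1ℙ m | 1ℙ = inj₁ ≡.refl

  Homogeneous-cong : ∀ {p f g} → f ≈ g → Homogeneous p f → Homogeneous p g
  Homogeneous-cong f≈g hf m e = F.trans (coeff-cong (sym f≈g) m) (hf m e)

  Homogeneous-+ : ∀ {p f g} → Homogeneous p f → Homogeneous p g → Homogeneous p (f + g)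
  Homogeneous-+ {f = f} {g} hf hg m e = F.trans (coeff-+ f g m)
    (F.trans (F.+-cong (hf m e) (hg m e)) (F.+-identityˡ _))

  Homogeneous-* : ∀ {p q f g} → Homogeneous p f → Homogeneous q g → Homogeneous (p ℙ.+ q) (f * g)
  Homogeneous-* {p} {q} {f} {g} hf hg m e = coeff-*-≈0 f g m step
    where
    step : ∀ i j → i ℤ.+ j ≡ m → coeff f i F.* coeff g j F.≈ F.0#
    step i j i+j≡m with parity-cases p i | parity-cases q j
    ... | inj₂ i∉ | _       = F.trans (F.*-congʳ (hf i i∉)) (F.zeroˡ _)
    ... | inj₁ _  | inj₂ j∉ = F.trans (F.*-congˡ (hg j j∉)) (F.zeroʳ _)
    ... | inj₁ i∈ | inj₁ j∈ = contradiction (begin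
      p ℙ.+ q                ≡⟨ cong₂ ℙ._+_ i∈ j∈ ⟨
      parity i ℙ.+ parity j  ≡⟨ parity-+ i j ⟨
      parity (i ℤ.+ j)       ≡⟨ cong parity i+j≡m ⟩
      parity m               ≡⟨ e ⟩
      (p ℙ.+ q) ⁻¹           ∎) (ℙ.p≢p⁻¹ _)
      where open ≡.≡-Reasoning

  Homogeneous-sum : ∀ {n p} (f : Row n) → (∀ i → Homogeneous p (f i)) → Homogeneous p (sum f)
  Homogeneous-sum {zero}  f hf = λ m _ → coeff-0 m
  Homogeneous-sum {suc n} f hf = Homogeneous-+ (hf zero) (Homogeneous-sum (f ∘ suc) (hf ∘ suc))

  Homogeneous-z : ∀ d → Homogeneous (parity d) (z d)
  Homogeneous-z d m m∉ = F.trans (coeff-cong (z≈mono d) m) (coeff-mono-≢ F.1# λ m≡d → ℙ.p≢p⁻¹ _ (≡.trans (cong parity (≡.sym m≡d)) m∉))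

  part-homogeneous : ∀ p f → Homogeneous p (part p f)
  part-homogeneous p f m = coeff-part-∉ p f

  -- Coefficients of the two degrees have disjoint supports, so a decomposition is determined
  -- coefficient by coefficient. The algebraic rules for `part` follow by exhibiting a
  -- decomposition.
  part-unique : ∀ {p f g h} → f ≈ g + h → Homogeneous p g → Homogeneous (p ⁻¹) h → part p f ≈ g
  part-unique {p} {f} {g} {h} f≈g+h hg hh = coeff-ext go
    where
    go : ∀ m → coeff (part p f) m F.≈ coeff g m
    go m with parity-cases p m
    ... | inj₂ m∉ = F.trans (coeff-part-∉ p f m∉) (F.sym (hg m m∉))
    ... | inj₁ m∈ = F.trans (coeff-part-∈ p f m∈) (F.trans (coeff-cong f≈g+h m)
      (F.trans (coeff-+ g h m) (F.trans (F.+-congˡ (hh m (≡.trans m∈ (≡.sym (ℙ.⁻¹-involutive p)))))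
      (F.+-identityʳ _))))

  part-split : ∀ p f → f ≈ part p f + part (p ⁻¹) f
  part-split p f = coeff-ext go
    where
    go : ∀ m → coeff f m F.≈ coeff (part p f + part (p ⁻¹) f) m
    go m with parity-cases p m
    ... | inj₁ m∈ = F.sym (F.trans (coeff-+ _ _ m) (F.trans (F.+-cong (coeff-part-∈ p f m∈)
      (coeff-part-∉ (p ⁻¹) f (≡.trans m∈ (≡.sym (ℙ.⁻¹-involutive p))))) (F.+-identityʳ _)))
    ... | inj₂ m∉ = F.sym (F.trans (coeff-+ _ _ m) (F.trans (F.+-cong (coeff-part-∉ p f m∉)
      (coeff-part-∈ (p ⁻¹) f m∉)) (F.+-identityˡ _)))

  part-cong : ∀ {p f g} → f ≈ g → part p f ≈ part p g
  part-cong {p} {f} {g} f≈g = part-unique (trans f≈g (part-split p g))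
    (part-homogeneous p g) (part-homogeneous (p ⁻¹) g)

  part-+ : ∀ p f g → part p (f + g) ≈ part p f + part p g
  part-+ p f g = part-unique {h = part (p ⁻¹) f + part (p ⁻¹) g}
    (trans (+-cong (part-split p f) (part-split p g)) (interchange _ _ _ _))
    (Homogeneous-+ (part-homogeneous p f) (part-homogeneous p g))
    (Homogeneous-+ (part-homogeneous (p ⁻¹) f) (part-homogeneous (p ⁻¹) g))
    where
    open Semigroup +-commutativeSemigroup using (interchange)

  part-* : ∀ p {q} f {w} → Homogeneous q w → part (p ℙ.+ q) (f * w) ≈ part p f * w
  part-* p {q} f {w} hw = part-unique
    (trans (*-congʳ (part-split p f)) (distribʳ w _ _))
    (Homogeneous-* (part-homogeneous p f) hw)
    (subst (λ r → Homogeneous r (part (p ⁻¹) f * w)) (⁻¹-+ p q)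
      (Homogeneous-* (part-homogeneous (p ⁻¹) f) hw))
    where
    ⁻¹-+ : ∀ p q → (p ⁻¹) ℙ.+ q ≡ (p ℙ.+ q) ⁻¹
    ⁻¹-+ 0ℙ q = ≡.refl
    ⁻¹-+ 1ℙ q = ≡.sym (ℙ.⁻¹-involutive q)

  part-0 : ∀ p → part p 0# ≈ 0#
  part-0 p = part-unique (sym (+-identityˡ 0#)) (λ m _ → coeff-0 m) (λ m _ → coeff-0 m)

  part-sum : ∀ {n} p (f : Row n) → part p (sum f) ≈ sum (part p ∘ f)
  part-sum {zero}  p f = part-0 p
  part-sum {suc n} p f = trans (part-+ p _ _) (+-congˡ (part-sum p (f ∘ suc)))

  part-⋆ : ∀ {n} p {q} (ξ : Row n) {W : Matrix n} → (∀ i j → Homogeneous q (W i j)) →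
           ∀ j → part (p ℙ.+ q) ((ξ ⋆ W) j) ≈ ((part p ∘ ξ) ⋆ W) j
  part-⋆ {n} p {q} ξ {W} hW j = trans (part-sum (p ℙ.+ q) (λ h → ξ h * W h j))
    (sum-cong-≋ {n} λ h → part-* p (ξ h) (hW h j))

  -- The vectors x of the lattice spanned by the rows of Λ for which z⁻ˢ times
  -- the odd part of x lies in the lattice too, written in the basis Λ.
  record Layer {n} (Λ : Matrix n) (s : ℤ) (ξ : Row n) : Set (c ⊔ ℓ) where
    constructor layer
    field
      integral : ∀ j → Val 0ℤ (ξ j)
      odd      : Row n
      odd-val  : ∀ j → Val s (odd j)
      odd-part : ∀ j → part 1ℙ ((ξ ⋆ Λ) j) ≈ (odd ⋆ Λ) j

  Layer-⊞ : ∀ {n} {Λ : Matrix n} {s ξ η} → Layer Λ s ξ → Layer Λ s η → Layer Λ s (ξ ⊞ η)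
  Layer-⊞ {Λ = Λ} {s} {ξ} {η} (layer iξ ω vω eω) (layer iη π vπ eπ) = layer
    (λ j → Val-+ (iξ j) (iη j)) (ω ⊞ π) (λ j → Val-+ (vω j) (vπ j)) λ j → begin
      part 1ℙ (((ξ ⊞ η) ⋆ Λ) j)                   ≈⟨ part-cong (⋆-distribʳ-⊞ Λ ξ η j) ⟩
      part 1ℙ ((ξ ⋆ Λ) j + (η ⋆ Λ) j)             ≈⟨ part-+ 1ℙ _ _ ⟩
      part 1ℙ ((ξ ⋆ Λ) j) + part 1ℙ ((η ⋆ Λ) j)   ≈⟨ +-cong (eω j) (eπ j) ⟩
      (ω ⋆ Λ) j + (π ⋆ Λ) j                       ≈⟨ ⋆-distribʳ-⊞ Λ ω π j ⟨
      ((ω ⊞ π) ⋆ Λ) j                             ∎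
    where open import Relation.Binary.Reasoning.Setoid setoid

  -- Multiplication by `W` sends odd parts to odd parts if `q` is even, and even parts to odd parts
  -- if `q` is odd. The bound -1 on the entries of `X` leaves room for z⁻¹ times an integral matrix,
  -- and costs one step in `s`.
  Layer-transfer : ∀ {n} {Λ Λ′ X W : Matrix n} {s η} q →
    s ℤ.≤ 1ℤ → (∀ i j → Val -1ℤ (X i j)) → (∀ i j → Homogeneous q (W i j)) →
    X · Λ ≋ Λ′ · W → Layer Λ′ s η → (∀ j → Val 0ℤ ((η ⋆ X) j)) → Layer Λ (s ℤ.- 1ℤ) (η ⋆ X)
  Layer-transfer {Λ = Λ} {Λ′} {X} {W} {s} {η} q s≤1 vX hW XΛ≋Λ′W (layer _ ω vω eω) iηX = go q hW
    where
    open import Relation.Binary.Reasoning.Setoid setoid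
    swap : ∀ ζ j → ((ζ ⋆ X) ⋆ Λ) j ≈ ((ζ ⋆ Λ′) ⋆ W) j
    swap ζ j = begin
      ((ζ ⋆ X) ⋆ Λ) j   ≈⟨ ⋆-assoc ζ X Λ j ⟩
      (ζ ⋆ (X · Λ)) j   ≈⟨ ⋆-congˡ {ξ = ζ} XΛ≋Λ′W j ⟩
      (ζ ⋆ (Λ′ · W)) j  ≈⟨ ⋆-assoc ζ Λ′ W j ⟨
      ((ζ ⋆ Λ′) ⋆ W) j  ∎
    even-part : ∀ j → part 0ℙ ((η ⋆ Λ′) j) ≈ ((η ⊟ ω) ⋆ Λ′) j
    even-part j = begin
      part 0ℙ x                      ≈⟨ xy-y _ _ ⟨
      part 0ℙ x + part 1ℙ x - part 1ℙ x ≈⟨ +-congʳ (part-split 0ℙ x) ⟨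
      x - part 1ℙ x                  ≈⟨ +-congˡ (-‿cong (eω j)) ⟩
      x - (ω ⋆ Λ′) j                 ≈⟨ ⋆-distribʳ-⊟ Λ′ η ω j ⟨
      ((η ⊟ ω) ⋆ Λ′) j               ∎
      where
      x = (η ⋆ Λ′) j
      xy-y : ∀ a b → a + b - b ≈ a
      xy-y a b = trans (+-assoc a b _) (trans (+-congˡ (-‿inverseʳ b)) (+-identityʳ a))
    go : ∀ q → (∀ i j → Homogeneous q (W i j)) → Layer Λ (s ℤ.- 1ℤ) (η ⋆ X)
    go 0ℙ hW = layer iηX (ω ⋆ X) (Val-⋆ vω vX) λ j → begin
      part 1ℙ (((η ⋆ X) ⋆ Λ) j)               ≈⟨ part-cong (swap η j) ⟩
      part 1ℙ (((η ⋆ Λ′) ⋆ W) j)              ≈⟨ part-⋆ 1ℙ (η ⋆ Λ′) hW j ⟩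
      ((part 1ℙ ∘ (η ⋆ Λ′)) ⋆ W) j            ≈⟨ ⋆-congʳ {M = W} eω j ⟩
      ((ω ⋆ Λ′) ⋆ W) j                        ≈⟨ swap ω j ⟨
      ((ω ⋆ X) ⋆ Λ) j                         ∎
    -- The even part of η Λ′ is (η - ω) Λ′, so η X itself enters the new odd part. Only its
    -- integrality is known, and `s ≤ 1` turns this into valuation at least s - 1.
    go 1ℙ hW = layer iηX (η ⋆ X ⊟ ω ⋆ X)
      (λ j → Val-+ (Val-≤ (ℤ.+-monoˡ-≤ -1ℤ s≤1) (iηX j)) (Val-neg (Val-⋆ vω vX j))) λ j → begin
      part 1ℙ (((η ⋆ X) ⋆ Λ) j)               ≈⟨ part-cong (swap η j) ⟩
      part 1ℙ (((η ⋆ Λ′) ⋆ W) j)              ≈⟨ part-⋆ 0ℙ (η ⋆ Λ′) hW j ⟩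
      ((part 0ℙ ∘ (η ⋆ Λ′)) ⋆ W) j            ≈⟨ ⋆-congʳ {M = W} even-part j ⟩
      (((η ⊟ ω) ⋆ Λ′) ⋆ W) j                  ≈⟨ swap (η ⊟ ω) j ⟨
      ((η ⊟ ω) ⋆ X ⋆ Λ) j                     ≈⟨ ⋆-congʳ {M = Λ} (⋆-distribʳ-⊟ X η ω) j ⟩
      ((η ⋆ X ⊟ ω ⋆ X) ⋆ Λ) j                 ∎

-- Comparing the contributions of two lattices.

-- This is n - 1 - i, by recursion on the index so that `position` and `embed` need no arithmetic.
after : ∀ {n} → Fin n → ℕ
after {suc n} zero = n
after (suc i)      = after i

position : ∀ {n} (i : Fin n) → Fin (after i) → Fin n
position zero    m = suc m
position (suc i) m = suc (position i m)

≤-or-position : ∀ {n} (i j : Fin n) → j Fin.≤ i ⊎ ∃[ m ] j ≡ position i m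
≤-or-position zero    zero    = inj₁ ℕ.z≤n
≤-or-position zero    (suc j) = inj₂ (j , ≡.refl)
≤-or-position (suc i) zero    = inj₁ ℕ.z≤n
≤-or-position (suc i) (suc j) with ≤-or-position i j
... | inj₁ j≤i       = inj₁ (ℕ.s≤s j≤i)
... | inj₂ (m , eq)  = inj₂ (m , cong suc eq)

module Comparison {c ℓ} (F : CommutativeRing c ℓ) (R : SeriesRing F) {N} (1<N : 1 ℕ.< N)
  (enumeration : Inverse (CommutativeRing.setoid F) (≡.setoid (Fin N))) where

  open Core F R public
  open Counting F.+-abelianGroup 1<N enumeration public
    using (V; _≗ᵛ_; _⊖ᵛ_; IsAdditive; kernel-image-≤)

  embed : ∀ {n} (i : Fin n) → V (suc (after i)) → V n
  embed zero    x         = x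
  embed (suc i) x zero    = F.0#
  embed (suc i) x (suc j) = embed i x j

  embed-cong : ∀ {n} (i : Fin n) {x y} → x ≗ᵛ y → embed i x ≗ᵛ embed i y
  embed-cong zero    x≗y         = x≗y
  embed-cong (suc i) x≗y zero    = F.refl
  embed-cong (suc i) x≗y (suc j) = embed-cong i x≗y j

  embed-⊖ : ∀ {n} (i : Fin n) x y → embed i (x ⊖ᵛ y) ≗ᵛ embed i x ⊖ᵛ embed i y
  embed-⊖ zero    x y j       = F.refl
  embed-⊖ (suc i) x y zero    = F.sym (F.-‿inverseʳ F.0#)
  embed-⊖ (suc i) x y (suc j) = embed-⊖ i x y j

  embed-≈0 : ∀ {n} (i : Fin n) x j → embed i x j F.≈ F.0# ⊎ i Fin.≤ j
  embed-≈0 zero    x j       = inj₂ ℕ.z≤n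
  embed-≈0 (suc i) x zero    = inj₁ F.refl
  embed-≈0 (suc i) x (suc j) with embed-≈0 i x j
  ... | inj₁ e   = inj₁ e
  ... | inj₂ i≤j = inj₂ (ℕ.s≤s i≤j)

  embed-injective : ∀ {n} (i : Fin n) x → (∀ j → embed i x j F.≈ F.0#) → ∀ m → x m F.≈ F.0#
  embed-injective zero    x e = e
  embed-injective (suc i) x e = embed-injective i x (e ∘ suc)

  -- The image of Layer Λ s in the constant terms kⁿ is the set of vectors
  -- supported on the coordinates j with κ j ≤ 1 - s.
  record Adapted {n} (Λ : Matrix n) (κ : Vector ℤ n) : Set (c ⊔ ℓ) where
    field
      nonneg     : ∀ j → 0ℤ ℤ.≤ κ j
      lift       : V n → Row n
      lift-cong  : ∀ {x y : V n} → x ≗ᵛ y → lift x ≈ʳ lift y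
      lift-⊖     : ∀ x y → lift (x ⊖ᵛ y) ≈ʳ lift x ⊟ lift y
      coeff-lift : ∀ x j → coeff (lift x j) 0ℤ F.≈ x j
      lift-layer : ∀ s x → (∀ j → x j F.≈ F.0# ⊎ κ j ℤ.≤ 1ℤ ℤ.- s) → Layer Λ s (lift x)
      layer-≈0   : ∀ {s ξ} → s ℤ.≤ 1ℤ → Layer Λ s ξ →
                   ∀ j → + 2 ℤ.- s ℤ.≤ κ j → coeff (ξ j) 0ℤ F.≈ F.0#

  Val-0⇒1 : ∀ {f} → Val 0ℤ f → coeff f 0ℤ F.≈ F.0# → Val 1ℤ f
  Val-0⇒1 {f} vf f₀≈0 m m<1 with m ℤ.≟ 0ℤ
  ... | yes ≡.refl = f₀≈0
  ... | no m≢0     = vf m (ℤ.≤∧≢⇒< (ℤ.i<j⇒i≤pred[j] m<1) m≢0)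

  -- If the bound fails at `i`, vectors with `suc (after i)` free coordinates are measured
  -- faithfully by `after i` coordinates, which `kernel-image-≤` forbids. The relation between `X`
  -- and `X*` expresses zL ⊆ L′, and the integrality of `X` expresses L′ ⊆ L.
  comparison : ∀ {n} {Λ Λ′ X X* W : Matrix n} {κ κ′ a a′ : Vector ℤ n} q →
    Adapted Λ κ → Adapted Λ′ κ′ → Decreasing a → Decreasing a′ → a ↭ κ → a′ ↭ κ′ →
    (∀ i j → Val 0ℤ (X i j)) → (∀ i j → Val 0ℤ (X* i j)) → X · X* ≋ scalar (z 1ℤ) →
    (∀ i j → Homogeneous q (W i j)) → X · Λ ≋ Λ′ · W →
    ∀ i → a i ℤ.≤ a′ i ℤ.+ 1ℤ
  comparison {n} {Λ} {Λ′} {X} {X*} {W} {κ} {κ′} {a} {a′} q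
    adapted adapted′ a↓ a′↓ (ρ , a∘ρ) (ρ′ , a′∘ρ′) vX vX* XX* hW XΛ i
    with a i ℤ.≤? a′ i ℤ.+ 1ℤ
  ... | yes a≤  = a≤
  ... | no  a≰  = contradiction (kernel-image-≤ h g h-additive g-additive independent)
                    (ℕ.<⇒≱ (ℕ.n<1+n (after i)))
    where
    module A  = Adapted adapted
    module A′ = Adapted adapted′
    open import Relation.Binary.Reasoning.Setoid setoid

    s : ℤ
    -- With 1 - s = a′ i, all positions from `i` on in the sorted sequence pass the test for L′_s.
    s = 1ℤ ℤ.- a′ i

    0≤a′ : 0ℤ ℤ.≤ a′ i
    0≤a′ = subst (0ℤ ℤ.≤_) (≡.trans (≡.sym (a′∘ρ′ (ρ′ ⟨$⟩ˡ i))) (cong a′ (inverseʳ ρ′))) (A′.nonneg _)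

    s≤1 : s ℤ.≤ 1ℤ
    s≤1 = ℤ.i≤j⇒i-k≤j (a′ i) {{ℤ.nonNegative 0≤a′}} ℤ.≤-refl

    s-1≤1 : s ℤ.- 1ℤ ℤ.≤ 1ℤ
    s-1≤1 = ℤ.i≤j⇒i-k≤j 1ℤ s≤1

    embedding : V (suc (after i)) → Row n
    embedding x = A′.lift (embed i x ∘ (ρ′ ⟨$⟩ʳ_))

    admissible : ∀ x j → embed i x (ρ′ ⟨$⟩ʳ j) F.≈ F.0# ⊎ κ′ j ℤ.≤ 1ℤ ℤ.- s
    admissible x j with embed-≈0 i x (ρ′ ⟨$⟩ʳ j)
    ... | inj₁ e   = inj₁ e
    ... | inj₂ i≤j = inj₂ (ℤ.≤-trans (ℤ.≤-reflexive (≡.sym (a′∘ρ′ j)))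
      (ℤ.≤-trans (a′↓ i _ i≤j) (ℤ.≤-reflexive (double (a′ i)))))
      where
      double : ∀ x → x ≡ 1ℤ ℤ.- (1ℤ ℤ.- x)
      double = solve-∀

    embedding-layer : ∀ x → Layer Λ′ s (embedding x)
    embedding-layer x = A′.lift-layer s _ (admissible x)

    target : Fin (after i) → Fin n
    target m = ρ ⟨$⟩ˡ position i m

    -- Positions up to `i` satisfy a ≥ a i ≥ a′ i + 2 = 2 - (s - 1), so `layer-≈0` kills their
    -- constant terms. The coordinates in `target` are the only ones left to test.
    vanish : ∀ {ξ} → Layer Λ (s ℤ.- 1ℤ) ξ → (∀ m → coeff (ξ (target m)) 0ℤ F.≈ F.0#) →
             ∀ j → Val 1ℤ (ξ j)
    vanish {ξ} ξ-layer ξ₀≈0 j = Val-0⇒1 (Layer.integral ξ-layer j) go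
      where
      go : coeff (ξ j) 0ℤ F.≈ F.0#
      go with ≤-or-position i (ρ ⟨$⟩ʳ j)
      ... | inj₂ (m , eq) = subst (λ j → coeff (ξ j) 0ℤ F.≈ F.0#)
        (≡.trans (cong (ρ ⟨$⟩ˡ_) (≡.sym eq)) (inverseˡ ρ)) (ξ₀≈0 m)
      ... | inj₁ j≤i      = A.layer-≈0 s-1≤1 ξ-layer j (subst (+ 2 ℤ.- (s ℤ.- 1ℤ) ℤ.≤_) (a∘ρ j)
        (ℤ.≤-trans (ℤ.≤-reflexive (shuffle (a′ i))) (ℤ.≤-trans (ℤ.i<j⇒suc[i]≤j (ℤ.≰⇒> a≰)) (a↓ _ i j≤i))))
        where
        shuffle : ∀ x → + 2 ℤ.- (1ℤ ℤ.- x ℤ.- 1ℤ) ≡ 1ℤ ℤ.+ (x ℤ.+ 1ℤ)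
        shuffle = solve-∀

    image : V (suc (after i)) → Row n
    image x = embedding x ⋆ X

    image-cong : ∀ {x y} → x ≗ᵛ y → image x ≈ʳ image y
    image-cong x≗y = ⋆-congʳ {M = X} (A′.lift-cong (embed-cong i x≗y ∘ (ρ′ ⟨$⟩ʳ_)))

    image-⊖ : ∀ x y → image (x ⊖ᵛ y) ≈ʳ image x ⊟ image y
    image-⊖ x y j = begin
      (embedding (x ⊖ᵛ y) ⋆ X) j            ≈⟨ ⋆-congʳ {M = X} (A′.lift-cong (embed-⊖ i x y ∘ (ρ′ ⟨$⟩ʳ_))) j ⟩
      (A′.lift ((embed i x ⊖ᵛ embed i y) ∘ (ρ′ ⟨$⟩ʳ_)) ⋆ X) j ≈⟨ ⋆-congʳ {M = X} (A′.lift-⊖ _ _) j ⟩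
      ((embedding x ⊟ embedding y) ⋆ X) j   ≈⟨ ⋆-distribʳ-⊟ X _ _ j ⟩
      (image x ⊟ image y) j                 ∎

    term : ℤ → V (suc (after i)) → V (after i)
    term d x m = coeff (image x (target m)) d

    term-additive : ∀ d → IsAdditive (term d)
    term-additive d = record
      { f-cong = λ x≗y m → coeff-cong (image-cong x≗y (target m)) d
      ; f-⊖    = λ x y m → F.trans (coeff-cong (image-⊖ x y (target m)) d) (coeff-- _ _ d) }

    -- `h` reads the class of the image modulo zL. On the kernel of `h` the image is divisible by z,
    -- and there `g` reads the class of the quotient.
    h g : V (suc (after i)) → V (after i)
    h = term 0ℤ
    g = term 1ℤ

    h-additive : IsAdditive h
    h-additive = term-additive 0ℤ

    g-additive : IsAdditive g
    g-additive = term-additive 1ℤ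

    z⁻¹X z⁻¹W : Matrix n
    z⁻¹X i = z -1ℤ ◂ X i
    z⁻¹W i = z -1ℤ ◂ W i

    z⁻¹XΛ : z⁻¹X · Λ ≋ Λ′ · z⁻¹W
    z⁻¹XΛ i j = begin
      (z⁻¹X i ⋆ Λ) j          ≈⟨ ◂-⋆ (z -1ℤ) (X i) Λ j ⟩
      z -1ℤ * (X i ⋆ Λ) j     ≈⟨ *-congˡ (XΛ i j) ⟩
      z -1ℤ * (Λ′ i ⋆ W) j    ≈⟨ ⋆-◂ (z -1ℤ) (Λ′ i) W j ⟨
      (Λ′ i ⋆ z⁻¹W) j         ∎

    independent : ∀ x y → (∀ m → h x m F.≈ F.0#) → (∀ m → g x m F.+ h y m F.≈ F.0#) →
                  (∀ m → x m F.≈ F.0#) × (∀ m → h y m F.≈ F.0#)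
    independent x y hx≈0 gx+hy≈0 = x≈0 , λ m → F.trans (F.sym (F.+-identityˡ _))
      (F.trans (F.+-congʳ (F.sym (gx≈0 m))) (gx+hy≈0 m))
      where
      η θ ζ : Row n
      η = embedding x
      θ = embedding y
      -- This is z⁻¹(η + zθ) in the coordinates of `Λ`. Its constant terms on `target` are `g x`
      -- plus `h y`, so the hypothesis puts it in zL.
      ζ = η ⋆ z⁻¹X ⊞ image y
      image-integral : ∀ x j → Val 0ℤ (image x j)
      image-integral x = Val-⋆ (Layer.integral (embedding-layer x)) vX
      image-layer : ∀ x → Layer Λ (s ℤ.- 1ℤ) (image x)
      image-layer x = Layer-transfer q s≤1 (λ i j → Val-≤ ℤ.-≤+ (vX i j)) hW XΛ
        (embedding-layer x) (image-integral x)
      η⋆z⁻¹X : ∀ j → (η ⋆ z⁻¹X) j ≈ z -1ℤ * image x j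
      η⋆z⁻¹X = ⋆-◂ (z -1ℤ) η X
      z⁻¹image-layer : Layer Λ (s ℤ.- 1ℤ) (η ⋆ z⁻¹X)
      z⁻¹image-layer = Layer-transfer (1ℙ ℙ.+ q) s≤1 (λ i j → Val-z* -1ℤ (vX i j))
        (λ i j → Homogeneous-* (Homogeneous-z -1ℤ) (hW i j)) z⁻¹XΛ (embedding-layer x)
        λ j → Val-cong (sym (η⋆z⁻¹X j)) (Val-z* -1ℤ (vanish (image-layer x) hx≈0 j))
      ζ-Val : ∀ j → Val 1ℤ (ζ j)
      ζ-Val = vanish (Layer-⊞ z⁻¹image-layer (image-layer y)) λ m →
        F.trans (coeff-+ _ _ 0ℤ) (F.trans (F.+-congʳ
          (F.trans (coeff-cong (η⋆z⁻¹X (target m)) 0ℤ) (coeff-z* -1ℤ _ 0ℤ))) (gx+hy≈0 m))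
      image⋆X* : ∀ x j → (image x ⋆ X*) j ≈ z 1ℤ * embedding x j
      image⋆X* x j = begin
        ((embedding x ⋆ X) ⋆ X*) j        ≈⟨ ⋆-assoc (embedding x) X X* j ⟩
        (embedding x ⋆ (X · X*)) j        ≈⟨ ⋆-congˡ {ξ = embedding x} XX* j ⟩
        (embedding x ⋆ scalar (z 1ℤ)) j   ≈⟨ ⋆-diag (embedding x) _ j ⟩
        embedding x j * z 1ℤ              ≈⟨ *-comm _ _ ⟩
        z 1ℤ * embedding x j              ∎
      -- Applying `X*` returns to the coordinates of `Λ′`: as ζ is divisible by z, so is η + zθ, and
      -- η has no constant term.
      ζ⋆X* : ∀ j → (ζ ⋆ X*) j ≈ η j + z 1ℤ * θ j
      ζ⋆X* j = begin
        (ζ ⋆ X*) j                                ≈⟨ ⋆-distribʳ-⊞ X* (η ⋆ z⁻¹X) (image y) j ⟩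
        ((η ⋆ z⁻¹X) ⋆ X*) j + (image y ⋆ X*) j    ≈⟨ +-cong (⋆-congʳ {M = X*} η⋆z⁻¹X j) (image⋆X* y j) ⟩
        ((z -1ℤ ◂ image x) ⋆ X*) j + z 1ℤ * θ j   ≈⟨ +-congʳ (◂-⋆ (z -1ℤ) (image x) X* j) ⟩
        z -1ℤ * (image x ⋆ X*) j + z 1ℤ * θ j     ≈⟨ +-congʳ (*-congˡ (image⋆X* x j)) ⟩
        z -1ℤ * (z 1ℤ * η j) + z 1ℤ * θ j         ≈⟨ +-congʳ (trans (z-+ -1ℤ 1ℤ (η j)) (z-0 (η j))) ⟩
        η j + z 1ℤ * θ j                          ∎
      η₀≈0 : ∀ j → coeff (η j) 0ℤ F.≈ F.0#
      η₀≈0 j = F.trans (F.sym (F.trans (coeff-+ _ _ 0ℤ) (F.trans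
        (F.+-congˡ (Val-z* 1ℤ (Layer.integral (embedding-layer y) j) 0ℤ (ℤ.+<+ ℕ.z<s))) (F.+-identityʳ _))))
        (Val-cong (ζ⋆X* j) (Val-⋆ {v = 1ℤ} {w = 0ℤ} ζ-Val vX* j) 0ℤ (ℤ.+<+ ℕ.z<s))
      x≈0 : ∀ m → x m F.≈ F.0#
      x≈0 = embed-injective i x λ j → subst (λ j → embed i x j F.≈ F.0#) (inverseʳ ρ′)
        (F.trans (F.sym (A′.coeff-lift _ (ρ′ ⟨$⟩ˡ j))) (η₀≈0 _))
      gx≈0 : ∀ m → g x m F.≈ F.0#
      gx≈0 m = F.trans (f-cong (λ m → F.trans (x≈0 m) (F.sym (F.-‿inverseʳ (x m)))) m)
        (F.trans (f-⊖ x x m) (F.-‿inverseʳ _))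
        where open IsAdditive g-additive

-- Block matrices are adapted.

splitAt-elim : ∀ {p} m {n} (P : Fin (m ℕ.+ n) → Set p) →
               (∀ i → P (i ↑ˡ n)) → (∀ i → P (m ↑ʳ i)) → ∀ i → P i
splitAt-elim zero    P l r i       = r i
splitAt-elim (suc m) P l r zero    = l zero
splitAt-elim (suc m) P l r (suc i) = splitAt-elim m (P ∘ suc) (l ∘ suc) r i

module AdaptedBlocks {c ℓ} (F : CommutativeRing c ℓ) (R : SeriesRing F) {N} (1<N : 1 ℕ.< N)
  (enumeration : Inverse (CommutativeRing.setoid F) (≡.setoid (Fin N))) where

  open Comparison F R 1<N enumeration public
  open import Relation.Binary.Reasoning.Setoid setoid

  infixr 6 _⊕_

  -- Has the same form as the sum used for `Λ`, now over the abstract ring, so that the two agree by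
  -- computation when the ring is k((z)).
  _⊕_ : ∀ {m n} → Matrix m → Matrix n → Matrix (m ℕ.+ n)
  _⊕_ {m} {n} M N =
    map (_++ replicate n 0#) M ++ map (replicate m 0# ++_) N

  sum-split : ∀ m {n} (f : Row (m ℕ.+ n)) → sum f ≈ sum (f ∘ (_↑ˡ n)) + sum (f ∘ (m ↑ʳ_))
  sum-split zero    f = sym (+-identityˡ _)
  sum-split (suc m) f = trans (+-congˡ (sum-split m (f ∘ suc))) (sym (+-assoc _ _ _))

  module _ {m n} (M : Matrix m) (N : Matrix n) where

    private
      ↖ : ∀ i j → (M ⊕ N) (i ↑ˡ n) (j ↑ˡ n) ≡ M i j
      ↖ i j = ≡.trans (≡.cong-app (lookup-++ˡ (map (_++ replicate n 0#) M) _ i) _) (lookup-++ˡ (M i) _ j)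

      ↗ : ∀ i j → (M ⊕ N) (i ↑ˡ n) (m ↑ʳ j) ≡ 0#
      ↗ i j = ≡.trans (≡.cong-app (lookup-++ˡ (map (_++ replicate n 0#) M) _ i) _) (lookup-++ʳ (M i) _ j)

      ↙ : ∀ i j → (M ⊕ N) (m ↑ʳ i) (j ↑ˡ n) ≡ 0#
      ↙ i j = ≡.trans (≡.cong-app (lookup-++ʳ (map (_++ replicate n 0#) M) _ i) _) (lookup-++ˡ {m = m} (replicate m 0#) _ j)

      ↘ : ∀ i j → (M ⊕ N) (m ↑ʳ i) (m ↑ʳ j) ≡ N i j
      ↘ i j = ≡.trans (≡.cong-app (lookup-++ʳ (map (_++ replicate n 0#) M) _ i) _) (lookup-++ʳ {m = m} (replicate m 0#) _ j)

    ⋆-⊕ˡ : ∀ ξ j → (ξ ⋆ (M ⊕ N)) (j ↑ˡ n) ≈ ((ξ ∘ (_↑ˡ n)) ⋆ M) j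
    ⋆-⊕ˡ ξ j = trans (sum-split m _) (trans (+-cong
      (sum-cong-≋ {m} λ h → *-congˡ (reflexive (↖ h j)))
      (sum-zero {n} _ λ h → trans (*-congˡ (reflexive (↙ h j))) (zeroʳ _))) (+-identityʳ _))

    ⋆-⊕ʳ : ∀ ξ j → (ξ ⋆ (M ⊕ N)) (m ↑ʳ j) ≈ ((ξ ∘ (m ↑ʳ_)) ⋆ N) j
    ⋆-⊕ʳ ξ j = trans (sum-split m _) (trans (+-cong
      (sum-zero {m} _ λ h → trans (*-congˡ (reflexive (↗ h j))) (zeroʳ _))
      (sum-cong-≋ {n} λ h → *-congˡ (reflexive (↘ h j)))) (+-identityˡ _))

    Layer-⊕ : ∀ {s ξ} → Layer M s (ξ ∘ (_↑ˡ n)) → Layer N s (ξ ∘ (m ↑ʳ_)) → Layer (M ⊕ N) s ξ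
    Layer-⊕ {s} {ξ} (layer iξ ω vω eω) (layer iη π vπ eπ) = layer
      (splitAt-elim m (λ j → Val 0ℤ (ξ j)) iξ iη) (ω ++ π)
      (splitAt-elim m (λ j → Val s ((ω ++ π) j))
        (λ j → subst (Val s) (≡.sym (lookup-++ˡ ω π j)) (vω j))
        (λ j → subst (Val s) (≡.sym (lookup-++ʳ ω π j)) (vπ j)))
      (splitAt-elim m (λ j → part 1ℙ ((ξ ⋆ (M ⊕ N)) j) ≈ ((ω ++ π) ⋆ (M ⊕ N)) j)
        (λ j → trans (part-cong (⋆-⊕ˡ ξ j)) (trans (eω j)
          (trans (⋆-congʳ {M = M} (λ h → reflexive (≡.sym (lookup-++ˡ ω π h))) j) (sym (⋆-⊕ˡ (ω ++ π) j)))))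
        (λ j → trans (part-cong (⋆-⊕ʳ ξ j)) (trans (eπ j)
          (trans (⋆-congʳ {M = N} (λ h → reflexive (≡.sym (lookup-++ʳ ω π h))) j) (sym (⋆-⊕ʳ (ω ++ π) j))))))

    Layer-⊕⁻ˡ : ∀ {s ξ} → Layer (M ⊕ N) s ξ → Layer M s (ξ ∘ (_↑ˡ n))
    Layer-⊕⁻ˡ {ξ = ξ} (layer iξ ω vω eω) = layer (iξ ∘ (_↑ˡ n)) (ω ∘ (_↑ˡ n)) (vω ∘ (_↑ˡ n))
      λ j → trans (part-cong (sym (⋆-⊕ˡ ξ j))) (trans (eω _) (⋆-⊕ˡ ω j))

    Layer-⊕⁻ʳ : ∀ {s ξ} → Layer (M ⊕ N) s ξ → Layer N s (ξ ∘ (m ↑ʳ_))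
    Layer-⊕⁻ʳ {ξ = ξ} (layer iξ ω vω eω) = layer (iξ ∘ (m ↑ʳ_)) (ω ∘ (m ↑ʳ_)) (vω ∘ (m ↑ʳ_))
      λ j → trans (part-cong (sym (⋆-⊕ʳ ξ j))) (trans (eω _) (⋆-⊕ʳ ω j))

  Layer-cong : ∀ {n} {Λ : Matrix n} {s ξ η} → ξ ≈ʳ η → Layer Λ s ξ → Layer Λ s η
  Layer-cong {Λ = Λ} ξ≈η (layer iξ ω vω eω) = layer (λ j → Val-cong (ξ≈η j) (iξ j)) ω vω
    λ j → trans (part-cong (⋆-congʳ {M = Λ} (λ h → sym (ξ≈η h)) j)) (eω j)

  -- The odd part is taken entry by entry and a block diagonal matrix does not mix the two groups of
  -- coordinates, so every condition splits.
  adapted-⊕ : ∀ {m n} {M : Matrix m} {N : Matrix n} {κ μ} →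
              Adapted M κ → Adapted N μ → Adapted (M ⊕ N) (κ ++ μ)
  adapted-⊕ {m} {n} {M} {N} {κ} {μ} adaptedM adaptedN = record
    { nonneg     = elim (λ j → 0ℤ ℤ.≤ (κ ++ μ) j)
        (λ j → subst (0ℤ ℤ.≤_) (≡.sym (κˡ j)) (A.nonneg j))
        (λ j → subst (0ℤ ℤ.≤_) (≡.sym (μʳ j)) (B.nonneg j))
    ; lift       = lift
    ; lift-cong  = λ {x} {y} x≗y → elim (λ j → lift x j ≈ lift y j)
        (λ j → trans (liftˡ x j) (trans (A.lift-cong (x≗y ∘ (_↑ˡ n)) j) (sym (liftˡ y j))))
        (λ j → trans (liftʳ x j) (trans (B.lift-cong (x≗y ∘ (m ↑ʳ_)) j) (sym (liftʳ y j))))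
    ; lift-⊖     = λ x y → elim (λ j → lift (x ⊖ᵛ y) j ≈ lift x j - lift y j)
        (λ j → trans (liftˡ (x ⊖ᵛ y) j) (trans (A.lift-⊖ _ _ j)
          (sym (+-cong (liftˡ x j) (-‿cong (liftˡ y j))))))
        (λ j → trans (liftʳ (x ⊖ᵛ y) j) (trans (B.lift-⊖ _ _ j)
          (sym (+-cong (liftʳ x j) (-‿cong (liftʳ y j))))))
    ; coeff-lift = λ x → elim (λ j → coeff (lift x j) 0ℤ F.≈ x j)
        (λ j → F.trans (coeff-cong (liftˡ x j) 0ℤ) (A.coeff-lift _ j))
        (λ j → F.trans (coeff-cong (liftʳ x j) 0ℤ) (B.coeff-lift _ j))
    ; lift-layer = λ s x small → Layer-⊕ M N
        (Layer-cong (λ j → sym (liftˡ x j)) (A.lift-layer s _ λ j →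
          subst (λ k → x (j ↑ˡ n) F.≈ F.0# ⊎ k ℤ.≤ 1ℤ ℤ.- s) (κˡ j) (small (j ↑ˡ n))))
        (Layer-cong (λ j → sym (liftʳ x j)) (B.lift-layer s _ λ j →
          subst (λ k → x (m ↑ʳ j) F.≈ F.0# ⊎ k ℤ.≤ 1ℤ ℤ.- s) (μʳ j) (small (m ↑ʳ j))))
    ; layer-≈0   = λ {s} {ξ} s≤1 l → elim (λ j → + 2 ℤ.- s ℤ.≤ (κ ++ μ) j → coeff (ξ j) 0ℤ F.≈ F.0#)
        (λ j large → A.layer-≈0 s≤1 (Layer-⊕⁻ˡ M N l) j (subst (+ 2 ℤ.- s ℤ.≤_) (κˡ j) large))
        (λ j large → B.layer-≈0 s≤1 (Layer-⊕⁻ʳ M N l) j (subst (+ 2 ℤ.- s ℤ.≤_) (μʳ j) large)) }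
    where
    module A = Adapted adaptedM
    module B = Adapted adaptedN
    elim = λ {p} → splitAt-elim {p} m {n}
    κˡ : ∀ j → (κ ++ μ) (j ↑ˡ n) ≡ κ j
    κˡ = lookup-++ˡ κ μ
    μʳ : ∀ j → (κ ++ μ) (m ↑ʳ j) ≡ μ j
    μʳ = lookup-++ʳ κ μ
    lift : V (m ℕ.+ n) → Row (m ℕ.+ n)
    lift x = A.lift (x ∘ (_↑ˡ n)) ++ B.lift (x ∘ (m ↑ʳ_))
    liftˡ : ∀ x j → lift x (j ↑ˡ n) ≈ A.lift (x ∘ (_↑ˡ n)) j
    liftˡ x j = reflexive (lookup-++ˡ (A.lift (x ∘ (_↑ˡ n))) _ j)
    liftʳ : ∀ x j → lift x (m ↑ʳ j) ≈ B.lift (x ∘ (m ↑ʳ_)) j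
    liftʳ x j = reflexive (lookup-++ʳ (A.lift (x ∘ (_↑ˡ n))) _ j)

  adapted-[] : Adapted [] []
  adapted-[] = record
    { nonneg = λ () ; lift = λ _ () ; lift-cong = λ _ () ; lift-⊖ = λ _ _ () ; coeff-lift = λ _ ()
    ; lift-layer = λ _ _ _ → layer (λ ()) (λ ()) (λ ()) (λ ()) ; layer-≈0 = λ _ _ () }

  mono-ext : ∀ {f a d} → coeff f d F.≈ a → (∀ {m} → m ≢ d → coeff f m F.≈ F.0#) → f ≈ mono a d
  mono-ext {f} {a} {d} e e≢ = coeff-ext go
    where
    go : ∀ m → coeff f m F.≈ coeff (mono a d) m
    go m with m ℤ.≟ d
    ... | yes ≡.refl = F.trans e (F.sym (coeff-mono-≡ a d))
    ... | no m≢d     = F.trans (e≢ m≢d) (F.sym (coeff-mono-≢ a m≢d))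

  mono-cong : ∀ {a b} d → a F.≈ b → mono a d ≈ mono b d
  mono-cong {a} d a≈b = mono-ext (F.trans (coeff-mono-≡ a d) a≈b) (coeff-mono-≢ a)

  mono-- : ∀ a b d → mono (a F.- b) d ≈ mono a d - mono b d
  mono-- a b d = sym (mono-ext
    (F.trans (coeff-- _ _ d) (F.+-cong (coeff-mono-≡ a d) (F.-‿cong (coeff-mono-≡ b d))))
    λ m≢d → F.trans (coeff-- _ _ _) (F.trans (F.+-cong (coeff-mono-≢ a m≢d)
      (F.-‿cong (coeff-mono-≢ b m≢d))) (F.-‿inverseʳ F.0#)))

  z*mono : ∀ e a d → z e * mono a d ≈ mono a (e ℤ.+ d)
  z*mono e a d = mono-ext
    (F.trans (coeff-z* e _ _) (F.trans (F.reflexive (cong (coeff (mono a d)) (cancel e d))) (coeff-mono-≡ a d)))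
    λ {m} m≢ → F.trans (coeff-z* e _ m) (coeff-mono-≢ a λ m-e≡d → m≢ (≡.trans (≡.sym (cancel′ e m)) (cong (λ x → e ℤ.+ x) m-e≡d)))
    where
    cancel : ∀ e d → e ℤ.+ d ℤ.- e ≡ d
    cancel = solve-∀
    cancel′ : ∀ e m → e ℤ.+ (m ℤ.- e) ≡ m
    cancel′ = solve-∀

  mono-≈0 : ∀ {a} d → a F.≈ F.0# → mono a d ≈ 0#
  mono-≈0 {a} d a≈0 = sym (trans (mono-ext {a = F.0#} (coeff-0 d) (λ {m} _ → coeff-0 m))
    (mono-cong d (F.sym a≈0)))

  Homogeneous-mono : ∀ a d → Homogeneous (parity d) (mono a d)
  Homogeneous-mono a d m m∉ = coeff-mono-≢ a λ m≡d → ℙ.p≢p⁻¹ _ (≡.trans (cong parity (≡.sym m≡d)) m∉)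

  Val-mono : ∀ {s d} a → a F.≈ F.0# ⊎ s ℤ.≤ d → Val s (mono a d)
  Val-mono {s} {d} a (inj₁ a≈0) = Val-cong (sym (mono-≈0 d a≈0)) (Val-0 s)
  Val-mono a (inj₂ s≤d) m m<s   = coeff-mono-≢ a (ℤ.<⇒≢ (ℤ.<-≤-trans m<s s≤d))

  part-homogeneous-≈ : ∀ {p f} → Homogeneous p f → part p f ≈ f
  part-homogeneous-≈ hf = part-unique (sym (+-identityʳ _)) hf (λ m _ → coeff-0 m)

  part-opposite-≈0 : ∀ {p f} → Homogeneous (p ⁻¹) f → part p f ≈ 0#
  part-opposite-≈0 hf = part-unique (sym (+-identityˡ _)) (λ m _ → coeff-0 m) hf

  -- For `s ≤ 1` no coordinate with contribution 0 is forced to vanish, so `layer-≈0` is vacuous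
  -- there.
  2-s≰0 : ∀ {s} → s ℤ.≤ 1ℤ → + 2 ℤ.- s ℤ.≰ 0ℤ
  2-s≰0 s≤1 2-s≤0 = contradiction (ℤ.≤-trans (ℤ.i-j≤0⇒i≤j {+ 2} 2-s≤0) s≤1) λ { (ℤ.+≤+ (ℕ.s≤s ())) }

  [_]₁ : Carrier → Matrix 1
  [ f ]₁ = (f ∷ []) ∷ []

  ⋆-[]₁ : ∀ ξ f → (ξ ⋆ [ f ]₁) zero ≈ f * ξ zero
  ⋆-[]₁ ξ f = trans (+-identityʳ _) (*-comm _ _)

  constant : V 1 → Row 1
  constant x j = mono (x j) 0ℤ

  -- Constants are even, so their odd part is 0 and they lie in every layer.
  adapted-1 : Adapted [ 1# ]₁ (0ℤ ∷ [])
  adapted-1 = record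
    { nonneg     = λ { zero → ℤ.≤-refl }
    ; lift       = constant
    ; lift-cong  = λ x≗y j → mono-cong 0ℤ (x≗y j)
    ; lift-⊖     = λ x y j → mono-- (x j) (y j) 0ℤ
    ; coeff-lift = λ x j → coeff-mono-≡ (x j) 0ℤ
    ; lift-layer = λ s x _ → layer (λ j → Val-mono (x j) (inj₂ ℤ.≤-refl)) (λ _ → 0#) (λ _ → Val-0 s)
        λ { zero → trans (part-opposite-≈0 (λ m e → F.trans
                     (coeff-cong (trans (⋆-[]₁ (constant x) 1#) (*-identityˡ _)) m)
                     (Homogeneous-mono (x zero) 0ℤ m e)))
                   (sym (trans (⋆-[]₁ (λ _ → 0#) 1#) (*-identityˡ _))) }
    ; layer-≈0   = λ { s≤1 _ zero 2-s≤0 → contradiction 2-s≤0 (2-s≰0 s≤1) } }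

  adapted-z : Adapted [ z 1ℤ ]₁ (1ℤ ∷ [])
  adapted-z = record
    { nonneg     = λ { zero → ℤ.+≤+ ℕ.z≤n }
    ; lift       = constant
    ; lift-cong  = λ x≗y j → mono-cong 0ℤ (x≗y j)
    ; lift-⊖     = λ x y j → mono-- (x j) (y j) 0ℤ
    ; coeff-lift = λ x j → coeff-mono-≡ (x j) 0ℤ
    ; lift-layer = λ s x small → layer (λ j → Val-mono (x j) (inj₂ ℤ.≤-refl)) (constant x)
        (λ { zero → Val-mono (x zero) (bound s (small zero)) })
        λ { zero → part-homogeneous-≈ λ m e → F.trans
                     (coeff-cong (trans (⋆-[]₁ (constant x) (z 1ℤ)) (z*mono 1ℤ (x zero) 0ℤ)) m)
                     (Homogeneous-mono (x zero) 1ℤ m e) }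
    ; layer-≈0   = λ { {s} {ξ} _ (layer _ ω vω eω) zero large → coefficient₁ ξ ω (eω zero) (vω zero 0ℤ (0<s s large)) } }
    where
    bound : ∀ {p} {P : Set p} s → P ⊎ 1ℤ ℤ.≤ 1ℤ ℤ.- s → P ⊎ s ℤ.≤ 0ℤ
    bound s (inj₁ p) = inj₁ p
    bound s (inj₂ 1≤1-s) = inj₂ (ℤ.≤-trans (ℤ.≤-reflexive (flip₁ s)) (ℤ.≤-trans (ℤ.+-monoʳ-≤ (s ℤ.- 1ℤ) 1≤1-s) (ℤ.≤-reflexive (flip₂ s))))
      where
      flip₁ : ∀ s → s ≡ s ℤ.- 1ℤ ℤ.+ 1ℤ
      flip₁ = solve-∀
      flip₂ : ∀ s → s ℤ.- 1ℤ ℤ.+ (1ℤ ℤ.- s) ≡ 0ℤ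
      flip₂ = solve-∀
    0<s : ∀ s → + 2 ℤ.- s ℤ.≤ 1ℤ → 0ℤ ℤ.< s
    0<s s large = ℤ.suc[i]≤j⇒i<j (ℤ.≤-trans (ℤ.≤-reflexive (flip₁ s)) (ℤ.≤-trans (ℤ.+-monoʳ-≤ (s ℤ.- 1ℤ) large) (ℤ.≤-reflexive (flip₂ s))))
      where
      flip₁ : ∀ s → 1ℤ ≡ s ℤ.- 1ℤ ℤ.+ (+ 2 ℤ.- s)
      flip₁ = solve-∀
      flip₂ : ∀ s → s ℤ.- 1ℤ ℤ.+ 1ℤ ≡ s
      flip₂ = solve-∀
    coefficient₁ : ∀ ξ ω → part 1ℙ ((ξ ⋆ [ z 1ℤ ]₁) zero) ≈ (ω ⋆ [ z 1ℤ ]₁) zero →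
              coeff (ω zero) 0ℤ F.≈ F.0# → coeff (ξ zero) 0ℤ F.≈ F.0#
    coefficient₁ ξ ω e ω₀≈0 = F.trans (F.sym (coeff-z* 1ℤ (ξ zero) 1ℤ)) (F.trans
      (F.sym (F.trans (coeff-part-∈ 1ℙ _ {1ℤ} ≡.refl) (coeff-cong (⋆-[]₁ ξ (z 1ℤ)) 1ℤ)))
      (F.trans (coeff-cong (trans e (⋆-[]₁ ω (z 1ℤ))) 1ℤ) (F.trans (coeff-z* 1ℤ (ω zero) 1ℤ) ω₀≈0)))

  module _ (i : ℕ) (1<i : 1 ℕ.< i) where

    [1z,0zⁱ] : Matrix 2
    [1z,0zⁱ] = (1# ∷ z 1ℤ ∷ []) ∷ (0# ∷ z (+ i) ∷ []) ∷ []

    private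
      M = [1z,0zⁱ]

      column₀ : ∀ ξ → (ξ ⋆ M) zero ≈ ξ zero
      column₀ ξ = trans (+-cong (*-identityʳ _) (trans (+-identityʳ _) (zeroʳ _))) (+-identityʳ _)

      column₁ : ∀ ξ → (ξ ⋆ M) (suc zero) ≈ z 1ℤ * ξ zero + z (+ i) * ξ (suc zero)
      column₁ ξ = +-cong (*-comm _ _) (trans (+-identityʳ _) (*-comm _ _))

      -- For odd i the lift of (x₀ , x₁) is corrected in its first entry, so
      -- that x₁ contributes an even vector.
      correction : Parity → F.Carrier → Carrier
      correction 0ℙ a = 0#
      correction 1ℙ a = mono a (+ i ℤ.- 1ℤ)

      p : Parity
      p = ℕ.parity i

      correction-cong : ∀ p {a b} → a F.≈ b → correction p a ≈ correction p b
      correction-cong 0ℙ a≈b = refl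
      correction-cong 1ℙ a≈b = mono-cong _ a≈b

      correction-- : ∀ p a b → correction p (a F.- b) ≈ correction p a - correction p b
      correction-- 0ℙ a b = sym (-‿inverseʳ 0#)
      correction-- 1ℙ a b = mono-- a b _

      0<i-1 : 0ℤ ℤ.< + i ℤ.- 1ℤ
      0<i-1 = ℤ.suc[i]≤j⇒i<j (ℤ.+-monoˡ-≤ -1ℤ (ℤ.+≤+ 1<i))

      correction-val : ∀ p a → Val 1ℤ (correction p a)
      correction-val 0ℙ a = Val-0 1ℤ
      correction-val 1ℙ a = Val-mono a (inj₂ (ℤ.i<j⇒suc[i]≤j 0<i-1))

      lift : V 2 → Row 2
      lift x zero       = mono (x zero) 0ℤ - correction p (x (suc zero))
      lift x (suc zero) = mono (x (suc zero)) 0ℤ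

      rearrange : ∀ a b c d → (a - b) - (c - d) ≈ (a - c) - (b - d)
      rearrange a b c d = begin
        (a - b) + - (c - d)        ≈⟨ +-congˡ (-‿+-comm c (- d)) ⟨
        (a - b) + (- c + - (- d))  ≈⟨ interchange _ _ _ _ ⟩
        (a - c) + (- b + - (- d))  ≈⟨ +-congˡ (-‿+-comm b (- d)) ⟩
        (a - c) - (b - d)          ∎
        where open Semigroup +-commutativeSemigroup using (interchange)

      -- The even part of the second entry of lift x ⋆ M.
      rest : Parity → F.Carrier → Carrier
      rest p a = mono a (+ i) - z 1ℤ * correction p a

      rest-even : ∀ q a → p ≡ q → Homogeneous 0ℙ (rest q a)
      rest-even 0ℙ a p≡0 m e = F.trans (coeff-- _ _ m) (F.trans (F.+-cong
        (subst (λ q → Homogeneous q (mono a (+ i))) p≡0 (Homogeneous-mono a (+ i)) m e)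
        (F.-‿cong (F.trans (coeff-cong (zeroʳ _) m) (coeff-0 m)))) (F.-‿inverseʳ F.0#))
      rest-even 1ℙ a p≡1 m e = F.trans (coeff-cong
        (trans (+-congˡ (-‿cong (trans (z*mono 1ℤ a _) (reflexive (cong (mono a) (suc-pred (+ i)))))))
          (-‿inverseʳ _)) m) (coeff-0 m)
        where
        suc-pred : ∀ x → 1ℤ ℤ.+ (x ℤ.- 1ℤ) ≡ x
        suc-pred = solve-∀

      correction-even : ∀ q a → p ≡ q → Homogeneous 0ℙ (correction q a)
      correction-even 0ℙ a p≡0 m _ = coeff-0 m
      correction-even 1ℙ a p≡1     = subst (λ q → Homogeneous q (mono a (+ i ℤ.- 1ℤ)))
        (≡.trans (parity-+ (+ i) -1ℤ) (cong (ℙ._+ 1ℙ) p≡1)) (Homogeneous-mono a (+ i ℤ.- 1ℤ))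

      first-even : ∀ x → Homogeneous 0ℙ (lift x zero)
      first-even x m e = F.trans (coeff-- _ _ m) (F.trans (F.+-cong
        (Homogeneous-mono (x zero) 0ℤ m e) (F.-‿cong (correction-even p (x (suc zero)) ≡.refl m e)))
        (F.-‿inverseʳ F.0#))

      second : ∀ x → (lift x ⋆ M) (suc zero) ≈ mono (x zero) 1ℤ + rest p (x (suc zero))
      second x = begin
        (lift x ⋆ M) (suc zero)
          ≈⟨ column₁ (lift x) ⟩
        z 1ℤ * (mono x₀ 0ℤ - C) + z (+ i) * mono x₁ 0ℤ
          ≈⟨ +-cong (distribˡ _ _ _) (trans (z*mono (+ i) x₁ 0ℤ) (reflexive (cong (mono x₁) (ℤ.+-identityʳ (+ i))))) ⟩
        z 1ℤ * mono x₀ 0ℤ + z 1ℤ * (- C) + mono x₁ (+ i)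
          ≈⟨ +-congʳ (+-cong (z*mono 1ℤ x₀ 0ℤ) (sym (-‿distribʳ-* _ _))) ⟩
        mono x₀ 1ℤ - z 1ℤ * C + mono x₁ (+ i)
          ≈⟨ trans (+-assoc _ _ _) (+-congˡ (+-comm _ _)) ⟩
        mono x₀ 1ℤ + rest p x₁ ∎
        where
        x₀ = x zero
        x₁ = x (suc zero)
        C = correction p x₁

      -- The odd part of the lifted vector is (0, x₀z), which is x₀z^(1-i) times the second row (0,
      -- z^i). The contribution i arises here: s ≤ 1 - i means i ≤ 1 - s.
      odd : V 2 → Row 2
      odd x zero       = 0#
      odd x (suc zero) = mono (x zero) (1ℤ ℤ.- + i)

      lift-layer : ∀ s x → (∀ j → x j F.≈ F.0# ⊎ (+ i ∷ 0ℤ ∷ []) j ℤ.≤ 1ℤ ℤ.- s) → Layer M s (lift x)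
      lift-layer s x small = layer integral (odd x) odd-val odd-part
        where
        integral : ∀ j → Val 0ℤ (lift x j)
        integral zero       = Val-+ (Val-mono _ (inj₂ ℤ.≤-refl))
          (Val-neg (Val-≤ (ℤ.+≤+ ℕ.z≤n) (correction-val p _)))
        integral (suc zero) = Val-mono _ (inj₂ ℤ.≤-refl)
        bound : ∀ {p} {P : Set p} → P ⊎ + i ℤ.≤ 1ℤ ℤ.- s → P ⊎ s ℤ.≤ 1ℤ ℤ.- + i
        bound (inj₁ e)     = inj₁ e
        bound (inj₂ i≤1-s) = inj₂ (ℤ.≤-trans (ℤ.≤-reflexive (flip₁ s (+ i)))
          (ℤ.≤-trans (ℤ.+-monoʳ-≤ (s ℤ.- + i) i≤1-s) (ℤ.≤-reflexive (flip₂ s (+ i)))))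
          where
          flip₁ : ∀ s i → s ≡ s ℤ.- i ℤ.+ i
          flip₁ = solve-∀
          flip₂ : ∀ s i → s ℤ.- i ℤ.+ (1ℤ ℤ.- s) ≡ 1ℤ ℤ.- i
          flip₂ = solve-∀
        odd-val : ∀ j → Val s (odd x j)
        odd-val zero       = Val-0 s
        odd-val (suc zero) = Val-mono (x zero) (bound (small zero))
        cancel : ∀ i → i ℤ.+ (1ℤ ℤ.- i) ≡ 1ℤ
        cancel = solve-∀
        odd-part : ∀ j → part 1ℙ ((lift x ⋆ M) j) ≈ (odd x ⋆ M) j
        odd-part zero       = trans (part-cong (column₀ (lift x)))
          (trans (part-opposite-≈0 (first-even x)) (sym (column₀ (odd x))))
        odd-part (suc zero) = begin
          part 1ℙ ((lift x ⋆ M) (suc zero))      ≈⟨ part-unique (second x) (Homogeneous-mono _ 1ℤ) (rest-even p _ ≡.refl) ⟩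
          mono (x zero) 1ℤ                       ≈⟨ reflexive (cong (mono (x zero)) (cancel (+ i))) ⟨
          mono (x zero) (+ i ℤ.+ (1ℤ ℤ.- + i))   ≈⟨ z*mono (+ i) (x zero) _ ⟨
          z (+ i) * odd x (suc zero)             ≈⟨ +-identityˡ _ ⟨
          0# + z (+ i) * odd x (suc zero)        ≈⟨ +-congʳ (zeroʳ _) ⟨
          z 1ℤ * 0# + z (+ i) * odd x (suc zero) ≈⟨ column₁ (odd x) ⟨
          (odd x ⋆ M) (suc zero)                 ∎

      -- In the second column the coefficient of z is the constant term of the first coordinate plus
      -- the coefficient of z^(1-i) in the second. The latter is 0 for ξ by integrality, as 1 - i <
      -- 0, and for ω because 1 - i < s. So ξ₀ and ω₀ have equal constant terms, and ω₀ is odd,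
      -- being the odd part of ξ₀.
      layer-≈0 : ∀ {s ξ} → s ℤ.≤ 1ℤ → Layer M s ξ →
                 ∀ j → + 2 ℤ.- s ℤ.≤ (+ i ∷ 0ℤ ∷ []) j → coeff (ξ j) 0ℤ F.≈ F.0#
      layer-≈0 s≤1 _ (suc zero) 2-s≤0 =
        contradiction 2-s≤0 (2-s≰0 s≤1)
      layer-≈0 {s} {ξ} s≤1 (layer iξ ω vω eω) zero large = F.trans (F.sym (coefficient₁ ξ (iξ (suc zero) _ 1-i<0)))
        (F.trans (F.sym (coeff-part-∈ 1ℙ _ {1ℤ} ≡.refl)) (F.trans (coeff-cong (eω (suc zero)) 1ℤ)
        (F.trans (coefficient₁ ω (vω (suc zero) _ 1-i<s)) ω₀≈0)))
        where
        coefficient₁ : ∀ ζ → coeff (ζ (suc zero)) (1ℤ ℤ.- + i) F.≈ F.0# →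
                       coeff ((ζ ⋆ M) (suc zero)) 1ℤ F.≈ coeff (ζ zero) 0ℤ
        coefficient₁ ζ e = F.trans (coeff-cong (column₁ ζ) 1ℤ) (F.trans (coeff-+ _ _ 1ℤ)
          (F.trans (F.+-cong (coeff-z* 1ℤ _ 1ℤ) (F.trans (coeff-z* (+ i) _ 1ℤ) e)) (F.+-identityʳ _)))
        ω₀≈0 : coeff (ω zero) 0ℤ F.≈ F.0#
        ω₀≈0 = F.trans (coeff-cong (trans (sym (column₀ ω)) (sym (eω zero))) 0ℤ) (coeff-part-∉ 1ℙ _ {0ℤ} ≡.refl)
        1-i<0 : 1ℤ ℤ.- + i ℤ.< 0ℤ
        1-i<0 = ≡.subst₂ ℤ._<_ (flip (+ i)) ≡.refl (ℤ.neg-mono-< 0<i-1)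
          where
          flip : ∀ i → ℤ.- (i ℤ.- 1ℤ) ≡ 1ℤ ℤ.- i
          flip = solve-∀
        1-i<s : 1ℤ ℤ.- + i ℤ.< s
        1-i<s = ℤ.suc[i]≤j⇒i<j (ℤ.≤-trans (ℤ.≤-reflexive (flip₁ s (+ i)))
          (ℤ.≤-trans (ℤ.+-monoʳ-≤ (s ℤ.- + i) large) (ℤ.≤-reflexive (flip₂ s (+ i)))))
          where
          flip₁ : ∀ s i → 1ℤ ℤ.+ (1ℤ ℤ.- i) ≡ s ℤ.- i ℤ.+ (+ 2 ℤ.- s)
          flip₁ = solve-∀
          flip₂ : ∀ s i → s ℤ.- i ℤ.+ i ≡ s
          flip₂ = solve-∀

    adapted-1z,0zⁱ : Adapted [1z,0zⁱ] (+ i ∷ 0ℤ ∷ [])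
    adapted-1z,0zⁱ = record
      { nonneg     = λ { zero → ℤ.+≤+ ℕ.z≤n ; (suc zero) → ℤ.≤-refl }
      ; lift       = lift
      ; lift-cong  = λ { x≗y zero       → +-cong (mono-cong 0ℤ (x≗y zero)) (-‿cong (correction-cong p (x≗y (suc zero))))
                       ; x≗y (suc zero) → mono-cong 0ℤ (x≗y (suc zero)) }
      ; lift-⊖     = λ { x y zero       → trans (+-cong (mono-- (x zero) (y zero) 0ℤ)
                                            (-‿cong (correction-- p (x (suc zero)) (y (suc zero)))))
                                            (rearrange _ _ _ _)
                       ; x y (suc zero) → mono-- (x (suc zero)) (y (suc zero)) 0ℤ }
      ; coeff-lift = λ { x zero       → F.trans (coeff-- _ _ 0ℤ) (F.trans (F.+-cong (coeff-mono-≡ _ 0ℤ)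
                                          (F.trans (F.-‿cong (correction-val p _ 0ℤ (ℤ.+<+ ℕ.z<s))) F.-0#≈0#))
                                          (F.+-identityʳ _))
                       ; x (suc zero) → coeff-mono-≡ _ 0ℤ }
      ; lift-layer = lift-layer
      ; layer-≈0   = layer-≈0 }

  -- From lattice inclusions to symmetric coweights.

  -- With `Val 0ℤ` this unfolds to K of the statement, while H is reached through its description by
  -- parity.
  GL : ∀ {n} → (Carrier → Set ℓ) → Matrix n → Set (c ⊔ ℓ)
  GL S M = (∀ i j → S (M i j)) ×
           ∃[ N ] (∀ i j → S (N i j)) × (M · N ≋ 𝟙) × (N · M ≋ 𝟙)

  -- The symmetric coweight, with any adapted matrix in place of Λ.
  record AdaptedCoweight {n} (B : Matrix n) (a : Vector ℤ n) : Set (c ⊔ ℓ) where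
    field
      {Λ P Q}       : Matrix n
      {κ}           : Vector ℤ n
      adapted       : Adapted Λ κ
      P∈K           : GL (Val 0ℤ) P
      Q∈H           : GL (Homogeneous 0ℙ) Q
      factorization : B ≋ (P · Λ) · Q
      decreasing    : Decreasing a
      permutation   : a ↭ κ

  z*z : ∀ {d e f} → d ℤ.+ e ≡ f → z d * z e ≈ z f
  z*z {d} {e} ≡.refl = trans (*-congˡ (z≈mono e)) (trans (z*mono d _ e) (sym (z≈mono (d ℤ.+ e))))

  Val-z : ∀ {s d} → s ℤ.≤ d → Val s (z d)
  Val-z {d = d} s≤d = Val-cong (sym (z≈mono d)) (Val-mono F.1# (inj₂ s≤d))

  Val-diag : ∀ {n s} (d : Row n) → (∀ i → Val s (d i)) → ∀ i j → Val s (diag d i j)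
  Val-diag {s = s} d vd i j with does (i Fin.≟ j)
  ... | true  = vd i
  ... | false = Val-0 s

  -- The factor `z e` makes one lemma serve both inequalities: after the change of basis, `W` is z^e
  -- times an even matrix, hence homogeneous of the parity of `e`.
  coweight-≤ : ∀ {n} {T T* B B′ : Matrix n} {a a′ : Vector ℤ n} e →
    (∀ i j → Val 0ℤ (T i j)) → (∀ i j → Val 0ℤ (T* i j)) → T · T* ≋ scalar (z 1ℤ) →
    T · B ≋ scalar (z e) · B′ → AdaptedCoweight B a → AdaptedCoweight B′ a′ →
    ∀ i → a i ℤ.≤ a′ i ℤ.+ 1ℤ
  coweight-≤ {n} {T} {T*} e vT vT* TT* TB coweight coweight′ with coweight | coweight′
  ... | record { P = P ; adapted = adapted ; P∈K = vP , P⁻¹ , vP⁻¹ , PP⁻¹ , _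
               ; Q∈H = _ , Q⁻¹ , eQ⁻¹ , QQ⁻¹ , _ ; factorization = B≋ ; decreasing = a↓ ; permutation = a↭ }
      | record { P = P′ ; Q = Q′ ; adapted = adapted′ ; P∈K = vP′ , P′⁻¹ , vP′⁻¹ , _ , P′⁻¹P′
               ; Q∈H = eQ′ , _ ; factorization = B′≋ ; decreasing = a′↓ ; permutation = a′↭ } =
    comparison {X = (P′⁻¹ · T) · P} {X* = (P⁻¹ · T*) · P′} {W = scalar (z e) · (Q′ · Q⁻¹)}
      (parity e ℙ.+ 0ℙ) adapted adapted′ a↓ a′↓ a↭ a′↭
      (λ i → Val-⋆ (Val-⋆ (vP′⁻¹ i) vT) vP) (λ i → Val-⋆ (Val-⋆ (vP⁻¹ i) vT*) vP′)
      (conjugate-inverse (scalar-central _) PP⁻¹ P′⁻¹P′ TT*)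
      (λ i j → Homogeneous-cong (sym (diag-· (λ _ → z e) (Q′ · Q⁻¹) i j))
        (Homogeneous-* (Homogeneous-z e) (Homogeneous-sum _ λ h →
          Homogeneous-* (eQ′ i h) (eQ⁻¹ h j))))
      (basis-change (scalar-central _) QQ⁻¹ P′⁻¹P′ B≋ B′≋ TB)
    where open BasisChange (·-monoid n)

  coweight-bounds : ∀ {n} {A B P Q : Matrix n} {a b d : Vector ℤ n} →
    GL (Val 0ℤ) P → GL (Val 0ℤ) Q → (∀ i → 0ℤ ℤ.≤ d i × d i ℤ.≤ 1ℤ) →
    A ≋ (P · diag (z ∘ d)) · Q → AdaptedCoweight B a → AdaptedCoweight (A · B) b →
    ∀ i → (a i ℤ.- 1ℤ ℤ.≤ b i) × (b i ℤ.≤ a i ℤ.+ 1ℤ)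
  coweight-bounds {n} {A} {B} {P} {Q} {a} {b} {d} (vP , P⁻¹ , vP⁻¹ , PP⁻¹ , P⁻¹P) (vQ , Q⁻¹ , vQ⁻¹ , QQ⁻¹ , Q⁻¹Q)
    d-bounds A≋ coweightB coweightAB i =
      subst (a i ℤ.- 1ℤ ℤ.≤_) (cancel (b i)) (ℤ.+-monoˡ-≤ -1ℤ (coweight-≤ 0ℤ vA vA* AA* AB coweightB coweightAB i))
    -- The roles of the lattices are exchanged: `A*` takes AB to zB, hence the exponent 1.
    , coweight-≤ 1ℤ vA* vA A*A A*AB coweightAB coweightB i
    where
    open BasisChange (·-monoid n)
    module M = Monoid (·-monoid n)
    -- `A*` is zA⁻¹. It is integral because the exponents 1 - d i are nonnegative.
    D D* A* : Matrix n
    D  = diag (z ∘ d)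
    D* = diag λ i → z (1ℤ ℤ.- d i)
    A* = (Q⁻¹ · D*) · P⁻¹
    cancel : ∀ x → x ℤ.+ 1ℤ ℤ.- 1ℤ ≡ x
    cancel = solve-∀
    diag-·-diag : ∀ {x} (d e : Row n) → (∀ i → d i * e i ≈ x) → diag d · diag e ≋ scalar x
    diag-·-diag {x} d e de≈x i j = trans (diag-· d (diag e) i j) (go (i Fin.≟ j))
      where
      go : Dec (i ≡ j) → d i * diag e i j ≈ scalar x i j
      go (yes ≡.refl) = trans (*-congˡ (reflexive (diag-≡ e i)))
        (trans (de≈x i) (reflexive (≡.sym (diag-≡ (λ _ → x) i))))
      go (no i≢j)     = trans (*-congˡ (reflexive (diag-≢ e i≢j)))
        (trans (zeroʳ _) (reflexive (≡.sym (diag-≢ (λ _ → x) i≢j))))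
    AA* : A · A* ≋ scalar (z 1ℤ)
    AA* = M.trans (M.∙-congʳ A≋) (conjugate-inverse (scalar-central _) QQ⁻¹ PP⁻¹
      (diag-·-diag _ _ λ i → z*z (sum≡1 (d i))))
      where
      sum≡1 : ∀ x → x ℤ.+ (1ℤ ℤ.- x) ≡ 1ℤ
      sum≡1 = solve-∀
    A*A : A* · A ≋ scalar (z 1ℤ)
    A*A = M.trans (M.∙-congˡ {A*} A≋) (conjugate-inverse (scalar-central _) P⁻¹P Q⁻¹Q
      (diag-·-diag _ _ λ i → z*z (sum≡1 (d i))))
      where
      sum≡1 : ∀ x → 1ℤ ℤ.- x ℤ.+ x ≡ 1ℤ
      sum≡1 = solve-∀
    vA : ∀ i j → Val 0ℤ (A i j)
    vA i j = Val-cong (sym (A≋ i j))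
      (Val-⋆ (Val-⋆ (vP i) (Val-diag _ (Val-z ∘ proj₁ ∘ d-bounds))) vQ j)
    vA* : ∀ i j → Val 0ℤ (A* i j)
    vA* i = Val-⋆ (Val-⋆ (vQ⁻¹ i) (Val-diag _ (Val-z ∘ ℤ.i≤j⇒0≤j-i ∘ proj₂ ∘ d-bounds))) vP⁻¹
    AB : A · B ≋ scalar (z 0ℤ) · (A · B)
    AB i j = sym (trans (diag-· _ (A · B) i j) (z-0 _))
    A*AB : A* · (A · B) ≋ scalar (z 1ℤ) · B
    A*AB = M.trans (M.sym (M.assoc A* A B)) (M.∙-congʳ A*A)

-- Laurent series form a commutative ring with the required coefficients.

module Series {c ℓ₁ ℓ₂} (k : HeytingField c ℓ₁ ℓ₂) where

  open LaurentSeries k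
  open Laurent

  module F where
    open CommutativeRing (HeytingCommutativeRing.commutativeRing
           (HeytingField.heytingCommutativeRing k)) public
    open Sum +-commutativeMonoid public
      using (sum; sum-cong-≋; ∑-distrib-+; sum-replicate-zero)
    open SemiringSum semiring public using (*-distribˡ-sum)
    open RingProperties ring public using (-0#≈0#)
    open Semigroup +-commutativeSemigroup public using (x∙yz≈y∙xz)

  open import Relation.Binary.Reasoning.Setoid F.setoid

  infixl 7 _⊛_
  infix  4 _≗ᶠ_

  PowerSeries : Set c
  PowerSeries = ℕ → F.Carrier

  _≗ᶠ_ : PowerSeries → PowerSeries → Set ℓ₁
  a ≗ᶠ b = ∀ m → a m F.≈ b m

  _⊛_ : PowerSeries → PowerSeries → PowerSeries
  (a ⊛ b) m = F.sum {suc m} λ i → a (toℕ i) F.* b (m ℕ.∸ toℕ i)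

  tail : PowerSeries → PowerSeries
  tail a m = a (suc m)

  -- Multiplication by z^d.
  pad : ℕ → PowerSeries → PowerSeries
  pad zero    a = a
  pad (suc d) a zero    = F.0#
  pad (suc d) a (suc m) = pad d a m

  ⊛-cong : ∀ {a a′ b b′} → a ≗ᶠ a′ → b ≗ᶠ b′ → a ⊛ b ≗ᶠ a′ ⊛ b′
  ⊛-cong a≈ b≈ m = F.sum-cong-≋ {suc m} λ i → F.*-cong (a≈ (toℕ i)) (b≈ (m ℕ.∸ toℕ i))

  ⊛-scale : ∀ x a b m → ((λ i → x F.* a i) ⊛ b) m F.≈ x F.* (a ⊛ b) m
  ⊛-scale x a b m = begin
    ((λ i → x F.* a i) ⊛ b) m
      ≈⟨ F.sum-cong-≋ {suc m} (λ i → F.*-assoc x (a (toℕ i)) (b (m ℕ.∸ toℕ i))) ⟩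
    F.sum {suc m} (λ i → x F.* (a (toℕ i) F.* b (m ℕ.∸ toℕ i)))
      ≈⟨ F.sym (F.*-distribˡ-sum {suc m} x λ i → a (toℕ i) F.* b (m ℕ.∸ toℕ i)) ⟩
    x F.* (a ⊛ b) m ∎

  ⊛-distribʳ : ∀ c a b m → ((λ i → a i F.+ b i) ⊛ c) m F.≈ (a ⊛ c) m F.+ (b ⊛ c) m
  ⊛-distribʳ c a b m = F.trans
    (F.sum-cong-≋ {suc m} λ i → F.distribʳ (c (m ℕ.∸ toℕ i)) (a (toℕ i)) (b (toℕ i)))
    (F.∑-distrib-+ {suc m} (λ i → a (toℕ i) F.* c (m ℕ.∸ toℕ i))
                           (λ i → b (toℕ i) F.* c (m ℕ.∸ toℕ i)))

  ⊛-zeroˡ : ∀ b m → ((λ _ → F.0#) ⊛ b) m F.≈ F.0#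
  ⊛-zeroˡ b m = F.trans
    (F.sum-cong-≋ {suc m} λ i → F.zeroˡ (b (m ℕ.∸ toℕ i)))
    (F.sum-replicate-zero (suc m))

  -- Induction on the coefficient, since the tail of a ⊛ b is a₀ times the tail of b plus (tail a) ⊛
  -- b. No double sum has to be reindexed.
  ⊛-assoc : ∀ a b c → (a ⊛ b) ⊛ c ≗ᶠ a ⊛ (b ⊛ c)
  ⊛-assoc a b c zero = begin
    (a 0 F.* b 0 F.+ F.0#) F.* c 0 F.+ F.0#  ≈⟨ F.+-congʳ (F.*-congʳ (F.+-identityʳ _)) ⟩
    (a 0 F.* b 0) F.* c 0 F.+ F.0#           ≈⟨ F.+-congʳ (F.*-assoc _ _ _) ⟩
    a 0 F.* (b 0 F.* c 0) F.+ F.0#           ≈⟨ F.+-congʳ (F.*-congˡ (F.sym (F.+-identityʳ _))) ⟩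
    a 0 F.* (b 0 F.* c 0 F.+ F.0#) F.+ F.0#  ∎
  ⊛-assoc a b c (suc m) = begin
    (a 0 F.* b 0 F.+ F.0#) F.* c (suc m) F.+
      ((λ i → a 0 F.* tail b i F.+ (tail a ⊛ b) i) ⊛ c) m
      ≈⟨ F.+-cong (F.*-congʳ (F.+-identityʳ _)) (⊛-distribʳ c (λ i → a 0 F.* tail b i) (tail a ⊛ b) m) ⟩
    (a 0 F.* b 0) F.* c (suc m) F.+
      (((λ i → a 0 F.* tail b i) ⊛ c) m F.+ ((tail a ⊛ b) ⊛ c) m)
      ≈⟨ F.+-cong (F.*-assoc _ _ _) (F.+-cong (⊛-scale (a 0) (tail b) c m) (⊛-assoc (tail a) b c m)) ⟩
    a 0 F.* (b 0 F.* c (suc m)) F.+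
      (a 0 F.* (tail b ⊛ c) m F.+ (tail a ⊛ (b ⊛ c)) m)
      ≈⟨ F.sym (F.+-assoc _ _ _) ⟩
    a 0 F.* (b 0 F.* c (suc m)) F.+ a 0 F.* (tail b ⊛ c) m F.+ (tail a ⊛ (b ⊛ c)) m
      ≈⟨ F.+-congʳ (F.sym (F.distribˡ _ _ _)) ⟩
    a 0 F.* (b ⊛ c) (suc m) F.+ (tail a ⊛ (b ⊛ c)) m ∎

  -- The product unfolds along its left factor by computation. This is the mirror recursion, which
  -- commutativity needs.
  ⊛-tailʳ : ∀ a b m → (a ⊛ b) (suc m) F.≈ a (suc m) F.* b 0 F.+ (a ⊛ tail b) m
  ⊛-tailʳ a b zero = begin
    a 0 F.* b 1 F.+ (a 1 F.* b 0 F.+ F.0#)  ≈⟨ F.x∙yz≈y∙xz _ _ _ ⟩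
    a 1 F.* b 0 F.+ (a 0 F.* b 1 F.+ F.0#)  ∎
  ⊛-tailʳ a b (suc m) = begin
    a 0 F.* b (suc (suc m)) F.+ (tail a ⊛ b) (suc m)
      ≈⟨ F.+-congˡ (⊛-tailʳ (tail a) b m) ⟩
    a 0 F.* b (suc (suc m)) F.+ (a (suc (suc m)) F.* b 0 F.+ (tail a ⊛ tail b) m)
      ≈⟨ F.x∙yz≈y∙xz _ _ _ ⟩
    a (suc (suc m)) F.* b 0 F.+ (a ⊛ tail b) (suc m) ∎

  ⊛-comm : ∀ a b → a ⊛ b ≗ᶠ b ⊛ a
  ⊛-comm a b zero    = F.+-congʳ (F.*-comm _ _)
  ⊛-comm a b (suc m) = begin
    a 0 F.* b (suc m) F.+ (tail a ⊛ b) m  ≈⟨ F.+-cong (F.*-comm _ _) (⊛-comm (tail a) b m) ⟩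
    b (suc m) F.* a 0 F.+ (b ⊛ tail a) m  ≈⟨ F.sym (⊛-tailʳ b a m) ⟩
    (b ⊛ a) (suc m)                       ∎

  pad-⊛ : ∀ d a b → pad d a ⊛ b ≗ᶠ pad d (a ⊛ b)
  pad-⊛ zero    a b m       = F.refl
  pad-⊛ (suc d) a b zero    = F.trans (F.+-identityʳ _) (F.zeroˡ _)
  pad-⊛ (suc d) a b (suc m) = F.trans (F.+-congʳ (F.zeroˡ _))
    (F.trans (F.+-identityˡ _) (pad-⊛ d a b m))

  extend-cong : ∀ {a b} → a ≗ᶠ b → ∀ x → extend a x F.≈ extend b x
  extend-cong a≈b (+ m)    = a≈b m
  extend-cong a≈b -[1+ m ] = F.refl

  extend-+ : ∀ a b x → extend (λ i → a i F.+ b i) x F.≈ extend a x F.+ extend b x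
  extend-+ a b (+ m)    = F.refl
  extend-+ a b -[1+ m ] = F.sym (F.+-identityˡ _)

  extend-negative : ∀ a {x} → x ℤ.< 0ℤ → extend a x ≡ F.0#
  extend-negative a { -[1+ m ]} x<0       = ≡.refl
  extend-negative a {+ m}      (ℤ.+<+ ())

  extend-pad : ∀ d a x → extend (pad d a) x ≡ extend a (x ℤ.- + d)
  extend-pad zero    a x             = cong (extend a) (≡.sym (ℤ.+-identityʳ x))
  extend-pad (suc d) a (+ zero)      = ≡.refl
  extend-pad (suc d) a (+ suc m)     = ≡.trans (extend-pad d a (+ m)) (cong (extend a)
    (cancel-1 (+ m) (+ d)))
    where
    cancel-1 : ∀ x y → x ℤ.- y ≡ (1ℤ ℤ.+ x) ℤ.- (1ℤ ℤ.+ y)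
    cancel-1 = solve-∀
  extend-pad (suc d) a -[1+ m ]      = ≡.refl

  build : ℤ → (ℤ → F.Carrier) → Laurent
  build o φ = laurent o λ m → φ (o ℤ.+ + m)

  private
    cancel : ∀ o x → o ℤ.+ (x ℤ.- o) ≡ x
    cancel = solve-∀

    cancel′ : ∀ o x → (o ℤ.+ x) ℤ.- o ≡ x
    cancel′ = solve-∀

    x-o<0 : ∀ {x o} → x ℤ.< o → x ℤ.- o ℤ.< 0ℤ
    x-o<0 {x} {o} x<o = subst (x ℤ.- o ℤ.<_) (ℤ.+-inverseʳ o) (ℤ.+-monoˡ-< (ℤ.- o) x<o)

    x<o : ∀ {x o} → x ℤ.- o ℤ.< 0ℤ → x ℤ.< o
    x<o {x} {o} x-o<0 = ≡.subst₂ ℤ._<_ (cancel o x) (ℤ.+-identityʳ o) (ℤ.+-monoʳ-< o x-o<0)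

  coeff-below : ∀ f {x} → x ℤ.< ord f → coeff f x ≡ F.0#
  coeff-below f x<o = extend-negative (series f) (x-o<0 x<o)

  coeff-series : ∀ f m → coeff f (ord f ℤ.+ + m) ≡ series f m
  coeff-series f m = cong (extend (series f)) (cancel′ (ord f) (+ m))

  coeff-build : ∀ o φ → (∀ {x} → x ℤ.< o → φ x F.≈ F.0#) →
                ∀ x → coeff (build o φ) x F.≈ φ x
  coeff-build o φ φ≈0 x = go (x ℤ.- o) ≡.refl
    where
    go : ∀ y → x ℤ.- o ≡ y → extend (λ m → φ (o ℤ.+ + m)) y F.≈ φ x
    go (+ m)    e = F.reflexive (cong φ (≡.trans (cong (λ y → o ℤ.+ y) (≡.sym e)) (cancel o x)))
    go -[1+ m ] e = F.sym (φ≈0 (x<o (subst (ℤ._< 0ℤ) (≡.sym e) ℤ.-<+)))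

  coeff-+ : ∀ f g x → coeff (f + g) x F.≈ coeff f x F.+ coeff g x
  coeff-+ f g = coeff-build _ _ λ x<o → F.trans
    (F.+-cong (F.reflexive (coeff-below f (ℤ.<-≤-trans x<o (ℤ.i⊓j≤i (ord f) (ord g)))))
              (F.reflexive (coeff-below g (ℤ.<-≤-trans x<o (ℤ.i⊓j≤j (ord f) (ord g))))))
    (F.+-identityˡ _)

  -_ : Laurent → Laurent
  - f = build (ord f) λ x → F.- coeff f x

  coeff-neg : ∀ f x → coeff (- f) x F.≈ F.- coeff f x
  coeff-neg f = coeff-build _ _ λ x<o →
    F.trans (F.-‿cong (F.reflexive (coeff-below f x<o))) F.-0#≈0#

  coeff-0 : ∀ x → coeff 0# x F.≈ F.0#
  coeff-0 x = go (x ℤ.- 0ℤ)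
    where
    go : ∀ y → extend (λ _ → F.0#) y F.≈ F.0#
    go (+ m)    = F.refl
    go -[1+ m ] = F.refl

  -- With a common o ≤ ord f, ord f′ this makes f * g and f′ * g comparable
  -- when f ≈ f′ have different orders.
  coeff-*-rebase : ∀ f g {o} → o ℤ.≤ ord f → ∀ x →
    coeff (f * g) x F.≈
      extend ((λ m → coeff f (o ℤ.+ + m)) ⊛ series g) (x ℤ.- (o ℤ.+ ord g))
  coeff-*-rebase f g {o} o≤ x = begin
    extend (series f ⊛ series g) (x ℤ.- (ord f ℤ.+ ord g))
      ≡⟨ cong (extend _) (≡.trans (shuffle x (ord f) (ord g) o) (cong (λ y → (x ℤ.- (o ℤ.+ ord g)) ℤ.- y) (≡.sym d≡))) ⟩
    extend (series f ⊛ series g) ((x ℤ.- (o ℤ.+ ord g)) ℤ.- + d)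
      ≡⟨ extend-pad d (series f ⊛ series g) (x ℤ.- (o ℤ.+ ord g)) ⟨
    extend (pad d (series f ⊛ series g)) (x ℤ.- (o ℤ.+ ord g))
      ≈⟨ extend-cong (λ m → F.sym (pad-⊛ d (series f) (series g) m)) (x ℤ.- (o ℤ.+ ord g)) ⟩
    extend (pad d (series f) ⊛ series g) (x ℤ.- (o ℤ.+ ord g))
      ≈⟨ extend-cong (⊛-cong {b = series g} rebase (λ _ → F.refl)) (x ℤ.- (o ℤ.+ ord g)) ⟩
    extend ((λ m → coeff f (o ℤ.+ + m)) ⊛ series g) (x ℤ.- (o ℤ.+ ord g)) ∎
    where
    d : ℕ
    d = ℤ.∣ ord f ℤ.- o ∣
    d≡ : + d ≡ ord f ℤ.- o
    d≡ = ℤ.0≤i⇒+∣i∣≡i (ℤ.i≤j⇒0≤j-i o≤)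
    shuffle : ∀ x p q o → x ℤ.- (p ℤ.+ q) ≡ (x ℤ.- (o ℤ.+ q)) ℤ.- (p ℤ.- o)
    shuffle = solve-∀
    shuffle′ : ∀ m p o → m ℤ.- (p ℤ.- o) ≡ (o ℤ.+ m) ℤ.- p
    shuffle′ = solve-∀
    rebase : pad d (series f) ≗ᶠ λ m → coeff f (o ℤ.+ + m)
    rebase m = F.reflexive (≡.trans (extend-pad d (series f) (+ m))
      (cong (extend (series f)) (≡.trans (cong (λ y → + m ℤ.- y) d≡) (shuffle′ (+ m) (ord f) o))))

  *-comm : ∀ f g → f * g ≈ g * f
  *-comm f g x = F.trans (extend-cong (⊛-comm (series f) (series g)) (x ℤ.- (ord f ℤ.+ ord g)))
    (F.reflexive (cong (λ o → extend (series g ⊛ series f) (x ℤ.- o)) (ℤ.+-comm (ord f) (ord g))))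

  *-congʳ : ∀ {g f f′} → f ≈ f′ → f * g ≈ f′ * g
  *-congʳ {g} {f} {f′} f≈f′ x = begin
    coeff (f * g) x   ≈⟨ coeff-*-rebase f g (ℤ.i⊓j≤i (ord f) (ord f′)) x ⟩
    extend ((λ m → coeff f (o ℤ.+ + m)) ⊛ series g) (x ℤ.- (o ℤ.+ ord g))
      ≈⟨ extend-cong (⊛-cong {b = series g} (λ m → f≈f′ (o ℤ.+ + m)) (λ _ → F.refl)) (x ℤ.- (o ℤ.+ ord g)) ⟩
    extend ((λ m → coeff f′ (o ℤ.+ + m)) ⊛ series g) (x ℤ.- (o ℤ.+ ord g))
      ≈⟨ F.sym (coeff-*-rebase f′ g (ℤ.i⊓j≤j (ord f) (ord f′)) x) ⟩
    coeff (f′ * g) x  ∎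
    where o = ord f ℤ.⊓ ord f′

  *-cong : ∀ {f f′ g g′} → f ≈ f′ → g ≈ g′ → f * g ≈ f′ * g′
  *-cong {f} {f′} {g} {g′} f≈ g≈ x = begin
    coeff (f * g) x    ≈⟨ *-congʳ {g} {f} {f′} f≈ x ⟩
    coeff (f′ * g) x   ≈⟨ *-comm f′ g x ⟩
    coeff (g * f′) x   ≈⟨ *-congʳ {f′} {g} {g′} g≈ x ⟩
    coeff (g′ * f′) x  ≈⟨ *-comm g′ f′ x ⟩
    coeff (f′ * g′) x  ∎

  *-assoc : ∀ f g h → (f * g) * h ≈ f * (g * h)
  *-assoc f g h x = F.trans (extend-cong (⊛-assoc (series f) (series g) (series h)) (x ℤ.- (ord f ℤ.+ ord g ℤ.+ ord h)))
    (F.reflexive (cong (λ o → extend (series f ⊛ (series g ⊛ series h)) (x ℤ.- o))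
      (ℤ.+-assoc (ord f) (ord g) (ord h))))

  coeff-z^* : ∀ d f x → coeff (z^ d * f) x F.≈ coeff f (x ℤ.- d)
  coeff-z^* d f x = F.trans (extend-cong one⊛ (x ℤ.- (d ℤ.+ ord f)))
    (F.reflexive (cong (extend (series f)) (shuffle x d (ord f))))
    where
    one⊛ : series (z^ d) ⊛ series f ≗ᶠ series f
    one⊛ zero    = F.trans (F.+-identityʳ _) (F.*-identityˡ _)
    one⊛ (suc m) = F.trans (F.+-cong (F.*-identityˡ _) (⊛-zeroˡ (series f) m)) (F.+-identityʳ _)
    shuffle : ∀ x d o → x ℤ.- (d ℤ.+ o) ≡ x ℤ.- d ℤ.- o
    shuffle = solve-∀

  *-identityˡ : ∀ f → 1# * f ≈ f
  *-identityˡ f x = F.trans (coeff-z^* 0ℤ f x) (F.reflexive (cong (coeff f) (ℤ.+-identityʳ x)))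

  -- The coefficient is a finite sum of such products. Both the valuation and the parity of a
  -- product are derived from this.
  coeff-*-≈0 : ∀ f g x → (∀ i j → i ℤ.+ j ≡ x → coeff f i F.* coeff g j F.≈ F.0#) →
               coeff (f * g) x F.≈ F.0#
  coeff-*-≈0 f g x vanish = go (x ℤ.- (ord f ℤ.+ ord g)) ≡.refl
    where
    go : ∀ y → x ℤ.- (ord f ℤ.+ ord g) ≡ y → extend (series f ⊛ series g) y F.≈ F.0#
    go -[1+ m ] e = F.refl
    go (+ m)    e = F.trans (F.sum-cong-≋ {suc m} λ i → F.trans
      (F.reflexive (≡.sym (cong₂ F._*_ (coeff-series f (toℕ i)) (coeff-series g (m ℕ.∸ toℕ i)))))
      (vanish (ord f ℤ.+ + toℕ i) (ord g ℤ.+ + (m ℕ.∸ toℕ i)) (indices i)))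
      (F.sum-replicate-zero (suc m))
      where
      indices : ∀ (i : Fin (suc m)) → ord f ℤ.+ + toℕ i ℤ.+ (ord g ℤ.+ + (m ℕ.∸ toℕ i)) ≡ x
      indices i = ≡.trans (shuffle (ord f) (+ toℕ i) (ord g) _)
        (≡.trans (cong (λ y → ord f ℤ.+ ord g ℤ.+ + y) (ℕ.m+[n∸m]≡n (ℕ.s≤s⁻¹ (Fin.toℕ<n i))))
          (≡.trans (cong (λ y → ord f ℤ.+ ord g ℤ.+ y) (≡.sym e)) (cancel (ord f ℤ.+ ord g) x)))
        where
        shuffle : ∀ o i p j → o ℤ.+ i ℤ.+ (p ℤ.+ j) ≡ o ℤ.+ p ℤ.+ (i ℤ.+ j)
        shuffle = solve-∀

  *-distribʳ : ∀ h f g → (f + g) * h ≈ f * h + g * h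
  *-distribʳ h f g x = begin
    coeff ((f + g) * h) x
      ≈⟨ extend-cong (⊛-distribʳ (series h) sf sg) y ⟩
    extend (λ m → (sf ⊛ series h) m F.+ (sg ⊛ series h) m) y
      ≈⟨ extend-+ (sf ⊛ series h) (sg ⊛ series h) y ⟩
    extend (sf ⊛ series h) y F.+ extend (sg ⊛ series h) y
      ≈⟨ F.+-cong (F.sym (coeff-*-rebase f h (ℤ.i⊓j≤i (ord f) (ord g)) x))
                  (F.sym (coeff-*-rebase g h (ℤ.i⊓j≤j (ord f) (ord g)) x)) ⟩
    coeff (f * h) x F.+ coeff (g * h) x
      ≈⟨ F.sym (coeff-+ (f * h) (g * h) x) ⟩
    coeff (f * h + g * h) x ∎
    where
    o = ord f ℤ.⊓ ord g
    y = x ℤ.- (o ℤ.+ ord h)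
    sf sg : PowerSeries
    sf m = coeff f (o ℤ.+ + m)
    sg m = coeff g (o ℤ.+ + m)

  laurentRing : CommutativeRing c ℓ₁
  laurentRing = record
    { Carrier = Laurent ; _≈_ = _≈_ ; _+_ = _+_ ; _*_ = _*_ ; -_ = -_ ; 0# = 0# ; 1# = 1#
    ; isCommutativeRing = record
      { isRing = record
        { +-isAbelianGroup = record
          { isGroup = record
            { isMonoid = record
              { isSemigroup = record
                { isMagma = record
                  { isEquivalence = record
                    { refl  = λ _ → F.refl
                    ; sym   = λ e x → F.sym (e x)
                    ; trans = λ e e′ x → F.trans (e x) (e′ x) }
                  ; ∙-cong = λ {f} {f′} {g} {g′} e e′ x → F.trans (coeff-+ f g x)
                      (F.trans (F.+-cong (e x) (e′ x)) (F.sym (coeff-+ f′ g′ x))) }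
                ; assoc = λ f g h x → begin
                    coeff (f + g + h) x
                      ≈⟨ F.trans (coeff-+ (f + g) h x) (F.+-congʳ (coeff-+ f g x)) ⟩
                    coeff f x F.+ coeff g x F.+ coeff h x
                      ≈⟨ F.+-assoc _ _ _ ⟩
                    coeff f x F.+ (coeff g x F.+ coeff h x)
                      ≈⟨ F.sym (F.trans (coeff-+ f (g + h) x) (F.+-congˡ (coeff-+ g h x))) ⟩
                    coeff (f + (g + h)) x ∎ }
              ; identity = (λ f x → F.trans (coeff-+ 0# f x) (F.trans (F.+-congʳ (coeff-0 x)) (F.+-identityˡ _)))
                         , (λ f x → F.trans (coeff-+ f 0# x) (F.trans (F.+-congˡ (coeff-0 x)) (F.+-identityʳ _))) }
            ; inverse = (λ f x → F.trans (coeff-+ (- f) f x) (F.trans (F.+-congʳ (coeff-neg f x))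
                           (F.trans (F.-‿inverseˡ _) (F.sym (coeff-0 x)))))
                      , (λ f x → F.trans (coeff-+ f (- f) x) (F.trans (F.+-congˡ (coeff-neg f x))
                           (F.trans (F.-‿inverseʳ _) (F.sym (coeff-0 x)))))
            ; ⁻¹-cong = λ {f} {g} e x → F.trans (coeff-neg f x)
                (F.trans (F.-‿cong (e x)) (F.sym (coeff-neg g x))) }
          ; comm = λ f g x → F.trans (coeff-+ f g x)
              (F.trans (F.+-comm _ _) (F.sym (coeff-+ g f x))) }
        ; *-cong = λ {f} {f′} {g} {g′} → *-cong {f} {f′} {g} {g′}
        ; *-assoc = *-assoc
        ; *-identity = *-identityˡ , λ f x → F.trans (*-comm f 1# x) (*-identityˡ f x)
        ; distrib = (λ f g h x → begin
              coeff (f * (g + h)) x    ≈⟨ *-comm f (g + h) x ⟩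
              coeff ((g + h) * f) x    ≈⟨ *-distribʳ f g h x ⟩
              coeff (g * f + h * f) x  ≈⟨ F.trans (coeff-+ (g * f) (h * f) x) (F.+-cong (*-comm g f x) (*-comm h f x)) ⟩
              coeff (f * g) x F.+ coeff (f * h) x ≈⟨ F.sym (coeff-+ (f * g) (f * h) x) ⟩
              coeff (f * g + f * h) x  ∎)
          , *-distribʳ }
      ; *-comm = *-comm } }

  part-coeff : Parity → (ℤ → F.Carrier) → ℤ → F.Carrier
  part-coeff p φ m = if does (parity m ℙ.≟ p) then φ m else F.0#

  part-coeff-∈ : ∀ {p} φ {m} → parity m ≡ p → part-coeff p φ m ≡ φ m
  part-coeff-∈ {p} φ {m} m∈ with parity m ℙ.≟ p
  ... | yes _  = ≡.refl
  ... | no m∉  = contradiction m∈ m∉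

  part-coeff-∉ : ∀ {p} φ {m} → parity m ≡ p ⁻¹ → part-coeff p φ m ≡ F.0#
  part-coeff-∉ {p} φ {m} m∉ with parity m ℙ.≟ p
  ... | yes m∈ = contradiction (≡.trans (≡.sym m∈) m∉) (ℙ.p≢p⁻¹ p)
  ... | no _   = ≡.refl

  coeff-part : ∀ p f m → coeff (build (ord f) (part-coeff p (coeff f))) m F.≈ part-coeff p (coeff f) m
  coeff-part p f = coeff-build (ord f) (part-coeff p (coeff f)) below
    where
    below : ∀ {x} → x ℤ.< ord f → part-coeff p (coeff f) x F.≈ F.0#
    below {x} x< with parity x ℙ.≟ p
    ... | yes _ = F.reflexive (coeff-below f x<)
    ... | no _  = F.refl

  constant : F.Carrier → ℕ → F.Carrier
  constant a zero    = a
  constant a (suc m) = F.0#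

  coeff-monomial-≢ : ∀ a {d m} → m ≢ d → coeff (laurent d (constant a)) m F.≈ F.0#
  coeff-monomial-≢ a {d} {m} m≢d = go (m ℤ.- d) ≡.refl
    where
    go : ∀ x → m ℤ.- d ≡ x → extend (constant a) x F.≈ F.0#
    go (+ zero)  e = contradiction (ℤ.i-j≡0⇒i≡j m d e) m≢d
    go (+ suc x) e = F.refl
    go -[1+ x ]  e = F.refl

  seriesRing : SeriesRing (HeytingCommutativeRing.commutativeRing (HeytingField.heytingCommutativeRing k))
  seriesRing = record
    { commutativeRing = laurentRing
    ; coeff        = coeff
    ; coeff-cong   = λ f≈g → f≈g
    ; coeff-ext    = λ f≈g → f≈g
    ; coeff-0      = coeff-0
    ; coeff-+      = coeff-+
    ; coeff-neg    = coeff-neg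
    ; coeff-*-≈0   = coeff-*-≈0
    ; mono         = λ a d → laurent d (constant a)
    ; coeff-mono-≡ = λ a d → F.reflexive (cong (extend (constant a)) (ℤ.+-inverseʳ d))
    ; coeff-mono-≢ = coeff-monomial-≢
    ; z            = z^
    ; z≈mono       = λ d m → extend-cong (λ { zero → F.refl ; (suc _) → F.refl }) (m ℤ.- d)
    ; coeff-z*     = coeff-z^*
    ; part         = λ p f → build (ord f) (part-coeff p (coeff f))
    ; coeff-part-∈ = λ p f {m} m∈ → F.trans (coeff-part p f m) (F.reflexive (part-coeff-∈ (coeff f) {m} m∈))
    ; coeff-part-∉ = λ p f {m} m∉ → F.trans (coeff-part p f m) (F.reflexive (part-coeff-∉ (coeff f) {m} m∉)) }

-- The theorem over a finite field.

ones-bounds : ∀ {n l} (i : Fin n) → 0ℤ ℤ.≤ ones {n} l i × ones {n} l i ℤ.≤ 1ℤ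
ones-bounds {l = l} i with does (toℕ i ℕ.<? l)
... | true  = ℤ.+≤+ ℕ.z≤n , ℤ.≤-refl
... | false = ℤ.≤-refl , ℤ.+≤+ ℕ.z≤n

-- With a single element 1 = 0, so 1 + 1 = 0, which the characteristic excludes. The strict bound
-- makes the powers of N strictly increasing in the count.
1<∣k∣ : ∀ {c ℓ₁ ℓ₂} (k : HeytingField c ℓ₁ ℓ₂) ((N , _) : IsFinite k) → Char≢2 k → 1 ℕ.< N
1<∣k∣ k (zero        , enumeration) char≢2 = contradiction (Inverse.to enumeration (HeytingField.0# k)) λ ()
1<∣k∣ k (suc zero    , enumeration) char≢2 = contradiction
  (trans (+-cong 1≈0 1≈0) (+-identityˡ 0#)) char≢2
  where
  open HeytingField k
  open Inverse enumeration
  unique : ∀ (x y : Fin 1) → x ≡ y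
  unique zero zero = ≡.refl
  1≈0 : 1# ≈ 0#
  1≈0 = trans (sym (strictlyInverseʳ 1#))
    (trans (from-cong (unique (to 1#) (to 0#))) (strictlyInverseʳ 0#))
1<∣k∣ k (suc (suc N) , enumeration) char≢2 = ℕ.s≤s (ℕ.s≤s ℕ.z≤n)

module SymmetricCoweights {c ℓ₁ ℓ₂} (k : HeytingField c ℓ₁ ℓ₂) (finite : IsFinite k) (char≢2 : Char≢2 k) where

  private
    module k = LaurentSeries k
  open k using (k⦅z²⦆)
  open Series k using (seriesRing)
  open AdaptedBlocks _ seriesRing (1<∣k∣ k finite char≢2) (proj₂ finite)

  even : ∀ {f} → f ∈ k⦅z²⦆ → Homogeneous 0ℙ f
  even {f} f∈ m m-odd with odd-half m m-odd
  ... | h , ≡.refl = f∈ h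

  adapted-block : ∀ {m} (β : Block m) → Adapted (k.blockMatrix β) (contribution β)
  adapted-block ⟨1⟩                = adapted-1
  adapted-block ⟨z⟩                = adapted-z
  adapted-block (⟨1z,0z^ i ⟩ 1<i)  = adapted-1z,0zⁱ i 1<i

  adapted : ∀ {n} (βs : Blocks n) → Adapted (k.Λ βs) (contributions βs)
  adapted ε        = adapted-[]
  adapted (β ▸ βs) = adapted-⊕ (adapted-block β) (adapted βs)

  even-GL : ∀ {n} {M : Matrix n} → M ∈ k.H → M ∈ GL (Homogeneous 0ℙ)
  even-GL (eM , N , eN , MN , NM) = (λ i j → even (eM i j)) , N , (λ i j → even (eN i j)) , MN , NM

  coweights : ∀ (n l : ℕ) (A B : Matrix n) → k.HasDominantCoweight A (ones l) →
    ∀ (a b : Vector ℤ n) → k.HasSymmetricCoweight B a → k.HasSymmetricCoweight (A · B) b →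
    ∀ i → (a i ℤ.- 1ℤ ℤ.≤ b i) × (b i ℤ.≤ a i ℤ.+ 1ℤ)
  coweights n l A B (_ , P , Q , P∈K , Q∈K , A≋) a b σB σAB =
    coweight-bounds P∈K Q∈K (ones-bounds {l = l}) A≋ (coweight σB) (coweight σAB)
    where
    coweight : ∀ {M : Matrix n} {a} → k.HasSymmetricCoweight M a → AdaptedCoweight M a
    coweight (βs , (P , Q , P∈K , Q∈H , M≋) , a↓ , a↭) = record
      { adapted = adapted βs ; P∈K = P∈K ; Q∈H = even-GL Q∈H ; factorization = M≋
      ; decreasing = a↓ ; permutation = a↭ }

theorem2p2 : ∀ {c ℓ₁ ℓ₂} (k : HeytingField c ℓ₁ ℓ₂) → IsFinite k → Char≢2 k →
    let open LaurentSeries k in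
    ∀ (n l : ℕ) → l ℕ.≤ n →
    ∀ (A B : Matrix n) → A ∈ G → B ∈ G →
    HasDominantCoweight A (ones l) →
    ∀ (a b : Vector ℤ n) → HasSymmetricCoweight B a → HasSymmetricCoweight (A · B) b →
    ∀ i → (a i ℤ.- 1ℤ ℤ.≤ b i) × (b i ℤ.≤ a i ℤ.+ 1ℤ)
theorem2p2 k finite char≢2 n l _ A B _ _ = coweights n l A B
  where open SymmetricCoweights k finite char≢2
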